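{- There exist a family of partial Boolean functions $(f_n)_{n\ge 1}$ and a family of partial Boolean functions $(g_n)_{n\ge 1}$ such that $\mathrm{R}(f_n)\to\infty$ and $\mathrm{R}(g_n)\to\infty$ as $n\to\infty$, and \[\mathrm{R}(f_n\circ g_n)=O\!\left(\mathrm{R}(f_n)^{2/3}\,\mathrm{R}(g_n)^{2/3}\,\log^{2/3}\mathrm{R}(f_n)\right).\]
   Context: A partial Boolean function on $n$ bits is a map $f\colon S\to\{0,1\}$ with $S=\mathrm{Dom}(f)\subseteq\{0,1\}^n$. A randomized decision tree is a probability distribution over deterministic decision trees; it computes $f$ to error $\epsilon$ if on every $x\in\mathrm{Dom}(f)$ it outputs $f(x)$ with probability at least $1-\epsilon$. $\mathrm{R}(f)$ denotes the minimum, over randomized decision trees computing $f$ to error $1/3$, of the maximum number of queries made by any decision tree in its support. For partial Boolean functions $f$ on $n$ bits and $g$ on $m$ bits, the composition $f\circ g$ is the partial function on $nm$ bits whose domain consists of strings $x^1x^2\cdots x^n$ with each $x^i\in\mathrm{Dom}(g)$ and $g(x^1)\cdots g(x^n)\in\mathrm{Dom}(f)$, with value $f(g(x^1)\cdots g(x^n))$. -}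

module Defs where

open import Data.Nat using (ℕ; zero; suc; _+_; _*_; _≤_; _<_; _⊔_)
open import Data.Nat.Logarithm public using (⌈log₂_⌉)
open import Data.Bool using (Bool; true; false; if_then_else_)
open import Data.Bool.Properties using (_≟_)
open import Data.Fin using (Fin; combine)
open import Data.Maybe using (Maybe; just; nothing)
open import Data.List using (List; []; _∷_)
open import Data.Product using (_×_; _,_; Σ; ∃)
open import Relation.Nullary using (does)
open import Relation.Binary.PropositionalEquality using (_≡_)

Input : ℕ → Set
Input n = Fin n → Bool

-- A partial Boolean function on n bits: nothing = outside Dom(f).
PartialFn : ℕ → Set
PartialFn n = Input n → Maybe Bool

data DT (n : ℕ) : Set where
  leaf : Bool → DT n
  node : Fin n → DT n → DT n → DT n

eval : ∀ {n} → DT n → Input n → Bool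
eval (leaf b) x = b
eval (node i l r) x = if x i then eval r x else eval l x

depth : ∀ {n} → DT n → ℕ
depth (leaf _) = 0
depth (node _ l r) = suc (depth l ⊔ depth r)

-- A randomized decision tree: a finite distribution with positive
-- natural-number weights; the entry (w , t) has weight (suc w), and the
-- probability of t is (suc w) / totalWeight.
RDT : ℕ → Set
RDT n = List (ℕ × DT n)

totalWeight : ∀ {n} → RDT n → ℕ
totalWeight [] = 0
totalWeight ((w , _) ∷ D) = suc w + totalWeight D

weightOutputting : ∀ {n} → RDT n → Input n → Bool → ℕ
weightOutputting [] x b = 0
weightOutputting ((w , t) ∷ D) x b =
  (if does (eval t x ≟ b) then suc w else 0) + weightOutputting D x b

cost : ∀ {n} → RDT n → ℕ
cost [] = 0
cost ((_ , t) ∷ D) = depth t ⊔ cost D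

-- D computes f to error 1/3: on every x ∈ Dom(f), Pr[output = f(x)] ≥ 2/3.
Computes : ∀ {n} → RDT n → PartialFn n → Set
Computes D f =
  0 < totalWeight D ×
  (∀ x b → f x ≡ just b → 2 * totalWeight D ≤ 3 * weightOutputting D x b)

IsR : ∀ {n} → PartialFn n → ℕ → Set
IsR f r =
  (Σ (RDT _) λ D → Computes D f × cost D ≤ r) ×
  (∀ D → Computes D f → r ≤ cost D)

allJust : ∀ n → (Fin n → Maybe Bool) → Maybe (Fin n → Bool)
allJust zero v = just (λ ())
allJust (suc n) v with v Fin.zero | allJust n (λ i → v (Fin.suc i))
... | just b | just w = just λ { Fin.zero → b ; (Fin.suc i) → w i }
... | _ | _ = nothing

compose : ∀ {n m} → PartialFn n → PartialFn m → PartialFn (n * m)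
compose {n} {m} f g x with allJust n (λ i → g (λ j → x (combine i j)))
... | just y = f y
... | nothing = nothing

TendsToInfinity : (ℕ → ℕ) → Set
TendsToInfinity s = ∀ M → ∃ λ N → ∀ k → N ≤ k → M ≤ s k

{-# OPTIONS --safe #-}
-- The outer function f is approximate indexing: the input consists of an address a of K bits and
-- a table with one cell for every b ∈ {0,1}^K, which is either empty (value 0) or marks exactly
-- the cells b whose agreements with a exceed the disagreements by at least D (value 1). The inner
-- function g is gap majority on M bits. A tree for f must find a marked cell; knowing only
-- O(D) address bits it hits one with tiny probability, so R(f) = Ω(D) for D ≈ √K log K. By a chi-square
-- argument R(g) = Ω(M). But a single random query to a copy of g predicts its value with bias
-- about M^(-1/2); sampling each of the K address blocks once therefore produces a guess b which, for
-- M ≈ K / log² K, is marked with high probability by Chebyshev's inequality, and reading the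
-- cell b costs M more queries: R(f ∘ g) = O(K).
--
-- That R is attained as a natural number is constructive: the randomized trees of cost at most r
-- solving a problem form a rational polyhedral cone, and Fourier–Motzkin elimination decides
-- whether it is trivial.
module Submission where

open import Defs
open import Data.Bool using (Bool; true; false; not; if_then_else_; _xor_)
open import Data.Bool.Properties using (_≟_)
open import Data.Fin using (Fin; zero; suc; splitAt; _↑ˡ_; _↑ʳ_; remQuot)
import Data.Fin as Fin
import Data.Fin.Properties as Finₚ
open import Data.Integer using (ℤ; -[1+_]; +[1+_]; 0ℤ; 1ℤ; -1ℤ; ∣_∣; +≤+; -≤-; -≤+)
import Data.Integer as Z
import Data.Integer.Properties as ℤₚ
import Data.Integer.Tactic.RingSolver as ℤ-Solver
open import Data.List using (List; []; _∷_; _++_; map; filter; cartesianProductWith; cartesianProduct)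
import Data.List as List
open import Data.List.Membership.Propositional using (_∈_)
open import Data.List.Membership.Propositional.Properties using (∈-map⁺; ∈-map⁻; ∈-++⁺ˡ; ∈-++⁺ʳ; ∈-++⁻; ∈-filter⁺; ∈-filter⁻; ∈-cartesianProductWith⁺; ∈-cartesianProductWith⁻; ∈-cartesianProduct⁺; ∈-cartesianProduct⁻; ∈-allFin)
open import Data.List.Relation.Unary.Any using (here; there)
open import Data.Maybe using (Maybe; just; nothing; fromMaybe)
open import Data.Nat using (ℕ; zero; suc)
import Data.Nat as N
open import Data.Nat.Logarithm using (⌈log₂⌉-mono-≤; ⌈log₂2^n⌉≡n)
import Data.Nat.Properties as ℕₚ
import Data.Nat.Tactic.RingSolver as ℕ-Solver
open import Data.Product using (Σ; ∃; _×_; _,_; proj₁; proj₂)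
open import Data.Rational using (ℚ; 0ℚ; 1ℚ; ½)
import Data.Rational as Q
import Data.Rational.Properties as ℚₚ
open import Data.Sum using (_⊎_; inj₁; inj₂)
open import Data.Vec using (Vec; []; _∷_; lookup; tabulate; allFin; replicate; _[_]≔_)
import Data.Vec as Vec
import Data.Vec.Properties as Vecₚ
open import Data.Vec.Relation.Unary.All using (All; []; _∷_)
open import Data.Vec.Relation.Unary.All.Properties using (tabulate⁺)
open import Level using (0ℓ)
open import Relation.Binary.PropositionalEquality using (_≡_; refl; sym; trans; cong; cong₂; subst; subst₂; _≗_; module ≡-Reasoning)
open import Relation.Nullary using (¬_; Dec; yes; no; does; contradiction)
open import Relation.Nullary.Decidable using (dec⇒maybe; dec-true; dec-false; from-yes; from-no)
open import Tactic.RingSolver using (solve-∀)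
open import Tactic.RingSolver.Core.AlmostCommutativeRing using (AlmostCommutativeRing; fromCommutativeRing)

-- The parameters come from one balance. Let 1/r be the bias of one sampled query to g, and ℓ = log₂
-- r. A tree for f may learn q address bits outright and then try q cells, so the threshold D must
-- exceed q by a margin of order ℓ·√K to survive the union bound; this margin is the source of the
-- logarithm. Taking q itself of order ℓ·√K costs only a constant factor. A guess sampled from the
-- blocks passes the threshold once K/r ≥ 2D, which makes √K of order ℓ·r. Hence R(f) is at least of
-- order ℓ²r, R(g) at least of order r², and R(f ∘ g) at most of order ℓ²r², while (ℓ²r · r² ·
-- ℓ)^(2/3) = ℓ²r². Lower bounds on R(f) and R(g) suffice because the right-hand side grows with
-- both. All arithmetic stays in ℚ, ℤ and ℕ: powers of 1 ± σ stand for exponentials, Bernoulli's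
-- inequality for estimates of them, K is chosen as a perfect square, and the exponent 2/3 is
-- removed by cubing.

ℚ-ring : AlmostCommutativeRing 0ℓ 0ℓ
ℚ-ring = fromCommutativeRing ℚₚ.+-*-commutativeRing (λ q → dec⇒maybe (0ℚ ℚₚ.≟ q))

-- Rational inequalities and powers

module OrderedField where
  open Q using (_+_; _*_; _-_; -_; _≤_; _<_)

  2ℚ 4ℚ : ℚ
  2ℚ = 1ℚ + 1ℚ
  4ℚ = 2ℚ + 2ℚ

  0≤1 : 0ℚ ≤ 1ℚ
  0≤1 = ℚₚ.nonNegative⁻¹ 1ℚ

  0≤½ : 0ℚ ≤ ½
  0≤½ = ℚₚ.nonNegative⁻¹ ½

  0<1 : 0ℚ < 1ℚ
  0<1 = ℚₚ.positive⁻¹ 1ℚ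

  -- Polynomial inequalities are mostly proved through this certificate: the ring solver checks the
  -- identity, and c is written as a sum of visibly nonnegative terms.
  ≤-by-diff : ∀ {a b} c → b ≡ a + c → 0ℚ ≤ c → a ≤ b
  ≤-by-diff {a} c refl 0≤c = subst (_≤ a + c) (ℚₚ.+-identityʳ a) (ℚₚ.+-monoʳ-≤ a 0≤c)

  <-by-diff : ∀ {a b} c → b ≡ a + c → 0ℚ < c → a < b
  <-by-diff {a} c refl 0<c = subst (_< a + c) (ℚₚ.+-identityʳ a) (ℚₚ.+-monoʳ-< a 0<c)

  diff≥0 : ∀ {a b} → a ≤ b → 0ℚ ≤ b - a
  diff≥0 {a} {b} a≤b = subst (_≤ b - a) (ℚₚ.+-inverseʳ a) (ℚₚ.+-monoˡ-≤ (- a) a≤b)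

  0≤+ : ∀ {a b} → 0ℚ ≤ a → 0ℚ ≤ b → 0ℚ ≤ a + b
  0≤+ = ℚₚ.+-mono-≤

  *-monoʳ : ∀ {a b} c → 0ℚ ≤ c → a ≤ b → c * a ≤ c * b
  *-monoʳ c 0≤c = ℚₚ.*-monoˡ-≤-nonNeg c {{Q.nonNegative 0≤c}}

  *-monoˡ : ∀ {a b} c → 0ℚ ≤ c → a ≤ b → a * c ≤ b * c
  *-monoˡ c 0≤c = ℚₚ.*-monoʳ-≤-nonNeg c {{Q.nonNegative 0≤c}}

  *-mono : ∀ {a b c d} → 0ℚ ≤ a → 0ℚ ≤ d → a ≤ b → c ≤ d → a * c ≤ b * d
  *-mono {a} {d = d} 0≤a 0≤d a≤b c≤d = ℚₚ.≤-trans (*-monoʳ a 0≤a c≤d) (*-monoˡ d 0≤d a≤b)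

  0≤* : ∀ {a b} → 0ℚ ≤ a → 0ℚ ≤ b → 0ℚ ≤ a * b
  0≤* {a} {b} 0≤a 0≤b = subst (_≤ a * b) (ℚₚ.*-zeroʳ a) (*-monoʳ a 0≤a 0≤b)

  0<* : ∀ {a b} → 0ℚ < a → 0ℚ < b → 0ℚ < a * b
  0<* {a} {b} 0<a 0<b = subst (_< a * b) (ℚₚ.*-zeroʳ a) (ℚₚ.*-monoʳ-<-pos a {{Q.positive 0<a}} 0<b)

  *-cancelˡ : ∀ {a b} c → 0ℚ < c → c * a ≤ c * b → a ≤ b
  *-cancelˡ c 0<c = ℚₚ.*-cancelˡ-≤-pos c {{Q.positive 0<c}}

  0≤sq : ∀ a → 0ℚ ≤ a * a
  0≤sq a with ℚₚ.≤-total 0ℚ a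
  ... | inj₁ 0≤a = 0≤* 0≤a 0≤a
  ... | inj₂ a≤0 = subst (0ℚ ≤_) (neg-sq a) (0≤* 0≤-a 0≤-a)
    where
    0≤-a : 0ℚ ≤ - a
    0≤-a = ℚₚ.neg-antimono-≤ a≤0
    neg-sq : ∀ a → - a * - a ≡ a * a
    neg-sq = solve-∀ ℚ-ring

  ι : ℕ → ℚ
  ι zero    = 0ℚ
  ι (suc n) = 1ℚ + ι n

  0≤ι : ∀ n → 0ℚ ≤ ι n
  0≤ι zero    = ℚₚ.≤-refl
  0≤ι (suc n) = 0≤+ 0≤1 (0≤ι n)

  0<ι : ∀ n → 0ℚ < ι (suc n)
  0<ι n = ℚₚ.<-≤-trans 0<1 (≤-by-diff (ι n) refl (0≤ι n))

  ι-+ : ∀ m n → ι (m N.+ n) ≡ ι m + ι n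
  ι-+ zero    n = sym (ℚₚ.+-identityˡ (ι n))
  ι-+ (suc m) n = trans (cong (1ℚ +_) (ι-+ m n)) (sym (ℚₚ.+-assoc 1ℚ (ι m) (ι n)))

  ι-* : ∀ m n → ι (m N.* n) ≡ ι m * ι n
  ι-* zero    n = sym (ℚₚ.*-zeroˡ (ι n))
  ι-* (suc m) n = trans (ι-+ n (m N.* n)) (trans (cong (ι n +_) (ι-* m n)) (distrib (ι m) (ι n)))
    where
    distrib : ∀ a b → b + a * b ≡ (1ℚ + a) * b
    distrib = solve-∀ ℚ-ring

  ι-mono : ∀ {m n} → m N.≤ n → ι m ≤ ι n
  ι-mono {n = n} N.z≤n = 0≤ι n
  ι-mono (N.s≤s m≤n) = ℚₚ.+-monoʳ-≤ 1ℚ (ι-mono m≤n)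

  ι-mono-< : ∀ {m n} → m N.< n → ι m < ι n
  ι-mono-< {m} m<n = ℚₚ.<-≤-trans (<-by-diff 1ℚ (ℚₚ.+-comm 1ℚ (ι m)) 0<1) (ι-mono m<n)

  ι-cancel : ∀ {m n} → ι m ≤ ι n → m N.≤ n
  ι-cancel {m} {n} ιm≤ιn with m ℕₚ.≤? n
  ... | yes m≤n = m≤n
  ... | no  m≰n = contradiction (ℚₚ.<-≤-trans (ι-mono-< (ℕₚ.≰⇒> m≰n)) ιm≤ιn) (ℚₚ.<-irrefl refl)

  inverse : ∀ {x} → 0ℚ < x → ∃ λ y → x * y ≡ 1ℚ × 0ℚ ≤ y
  inverse {x} 0<x = y , ℚₚ.*-inverseʳ x {{nz}} , ℚₚ.nonNegative⁻¹ y {{ℚₚ.pos⇒nonNeg y {{ℚₚ.1/pos⇒pos x {{pos}}}}}}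
    where
    pos : Q.Positive x
    pos = Q.positive 0<x
    nz : Q.NonZero x
    nz = ℚₚ.pos⇒nonZero x {{pos}}
    y : ℚ
    y = (Q.1/ x) {{nz}}

  0<ι⁺ : ∀ {n} → 0 N.< n → 0ℚ < ι n
  0<ι⁺ {suc n} _ = 0<ι n

  infixr 8 _^_
  _^_ : ℚ → ℕ → ℚ
  x ^ zero  = 1ℚ
  x ^ suc n = x * x ^ n

  0≤^ : ∀ {x} n → 0ℚ ≤ x → 0ℚ ≤ x ^ n
  0≤^ zero    0≤x = 0≤1
  0≤^ (suc n) 0≤x = 0≤* 0≤x (0≤^ n 0≤x)

  ^-+ : ∀ x m n → x ^ (m N.+ n) ≡ x ^ m * x ^ n
  ^-+ x zero    n = sym (ℚₚ.*-identityˡ (x ^ n))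
  ^-+ x (suc m) n = trans (cong (x *_) (^-+ x m n)) (sym (ℚₚ.*-assoc x (x ^ m) (x ^ n)))

  1≤^ : ∀ {x} n → 1ℚ ≤ x → 1ℚ ≤ x ^ n
  1≤^ zero    1≤x = ℚₚ.≤-refl
  1≤^ (suc n) 1≤x = *-mono 0≤1 (0≤^ n (ℚₚ.≤-trans 0≤1 1≤x)) 1≤x (1≤^ n 1≤x)

  ^-*-base : ∀ x y n → (x * y) ^ n ≡ x ^ n * y ^ n
  ^-*-base x y zero    = refl
  ^-*-base x y (suc n) = trans (cong (x * y *_) (^-*-base x y n)) (interchange x y (x ^ n) (y ^ n))
    where
    interchange : ∀ a b c d → a * b * (c * d) ≡ a * c * (b * d)
    interchange = solve-∀ ℚ-ring

  ^-≤1 : ∀ {x} n → 0ℚ ≤ x → x ≤ 1ℚ → x ^ n ≤ 1ℚ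
  ^-≤1 zero    0≤x x≤1 = ℚₚ.≤-refl
  ^-≤1 (suc n) 0≤x x≤1 = *-mono 0≤x 0≤1 x≤1 (^-≤1 n 0≤x x≤1)

  ^-antitone : ∀ {x m n} → 0ℚ ≤ x → x ≤ 1ℚ → m N.≤ n → x ^ n ≤ x ^ m
  ^-antitone {n = n} 0≤x x≤1 N.z≤n = ^-≤1 n 0≤x x≤1
  ^-antitone {x}  0≤x x≤1 (N.s≤s m≤n) = *-monoʳ x 0≤x (^-antitone 0≤x x≤1 m≤n)

  ι-^ : ∀ m n → ι (m N.^ n) ≡ ι m ^ n
  ι-^ m zero    = refl
  ι-^ m (suc n) = trans (ι-* m (m N.^ n)) (cong (ι m *_) (ι-^ m n))

  ^-mono : ∀ {x y} n → 0ℚ ≤ x → x ≤ y → x ^ n ≤ y ^ n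
  ^-mono zero    0≤x x≤y = ℚₚ.≤-refl
  ^-mono (suc n) 0≤x x≤y = *-mono 0≤x (0≤^ n (ℚₚ.≤-trans 0≤x x≤y)) x≤y (^-mono n 0≤x x≤y)

  ^-^-* : ∀ x m n → x ^ (m N.* n) ≡ (x ^ n) ^ m
  ^-^-* x zero    n = refl
  ^-^-* x (suc m) n = trans (^-+ x n (m N.* n)) (cong (x ^ n *_) (^-^-* x m n))

  bernoulli : ∀ {x} n → 0ℚ ≤ 1ℚ + x → 1ℚ + ι n * x ≤ (1ℚ + x) ^ n
  bernoulli {x} zero    _     = ℚₚ.≤-reflexive (trans (cong (1ℚ +_) (ℚₚ.*-zeroˡ x)) (ℚₚ.+-identityʳ 1ℚ))
  bernoulli {x} (suc n) 0≤1+x = ℚₚ.≤-trans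
    (≤-by-diff (ι n * (x * x)) (step (ι n) x) (0≤* (0≤ι n) (0≤sq x)))
    (*-monoʳ (1ℚ + x) 0≤1+x (bernoulli n 0≤1+x))
    where
    step : ∀ m x → (1ℚ + x) * (1ℚ + m * x) ≡ 1ℚ + (1ℚ + m) * x + m * (x * x)
    step = solve-∀ ℚ-ring

-- Expectations of independent bits

module Expectation where
  open OrderedField
  open Q using (_+_; _*_; _-_; -_; _≤_; _<_)

  ⟦_⟧ : Bool → ℚ
  ⟦ true ⟧  = 1ℚ
  ⟦ false ⟧ = 0ℚ

  0≤⟦⟧ : ∀ b → 0ℚ ≤ ⟦ b ⟧
  0≤⟦⟧ true  = 0≤1
  0≤⟦⟧ false = ℚₚ.≤-refl

  IsProb : ℚ → Set
  IsProb p = 0ℚ ≤ p × p ≤ 1ℚ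

  -- The bits are independent and the i-th one is true with probability pᵢ.
  𝔼 : ∀ {n} → Vec ℚ n → (Vec Bool n → ℚ) → ℚ
  𝔼 []       F = F []
  𝔼 (p ∷ ps) F = p * 𝔼 ps (λ v → F (true ∷ v)) + (1ℚ - p) * 𝔼 ps (λ v → F (false ∷ v))

  𝔼-cong : ∀ {n} (ps : Vec ℚ n) {F G} → (∀ v → F v ≡ G v) → 𝔼 ps F ≡ 𝔼 ps G
  𝔼-cong []       F≗G = F≗G []
  𝔼-cong (p ∷ ps) F≗G = cong₂ (λ x y → p * x + (1ℚ - p) * y)
    (𝔼-cong ps (λ v → F≗G (true ∷ v))) (𝔼-cong ps (λ v → F≗G (false ∷ v)))

  mix-mono : ∀ {p a b c d} → IsProb p → a ≤ b → c ≤ d → p * a + (1ℚ - p) * c ≤ p * b + (1ℚ - p) * d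
  mix-mono {p} (0≤p , p≤1) a≤b c≤d =
    ℚₚ.+-mono-≤ (*-monoʳ p 0≤p a≤b) (*-monoʳ (1ℚ - p) (diff≥0 p≤1) c≤d)

  𝔼-mono : ∀ {n} {ps : Vec ℚ n} {F G} → All IsProb ps → (∀ v → F v ≤ G v) → 𝔼 ps F ≤ 𝔼 ps G
  𝔼-mono []          F≤G = F≤G []
  𝔼-mono (pr ∷ prs) F≤G =
    mix-mono pr (𝔼-mono prs (λ v → F≤G (true ∷ v))) (𝔼-mono prs (λ v → F≤G (false ∷ v)))

  𝔼-const : ∀ {n} (ps : Vec ℚ n) c → 𝔼 ps (λ _ → c) ≡ c
  𝔼-const []       c = refl
  𝔼-const (p ∷ ps) c = trans (cong₂ (λ x y → p * x + (1ℚ - p) * y) (𝔼-const ps c) (𝔼-const ps c)) (mix p c)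
    where
    mix : ∀ p c → p * c + (1ℚ - p) * c ≡ c
    mix = solve-∀ ℚ-ring

  𝔼-+ : ∀ {n} (ps : Vec ℚ n) F G → 𝔼 ps (λ v → F v + G v) ≡ 𝔼 ps F + 𝔼 ps G
  𝔼-+ []       F G = refl
  𝔼-+ (p ∷ ps) F G = trans
    (cong₂ (λ x y → p * x + (1ℚ - p) * y) (𝔼-+ ps _ _) (𝔼-+ ps _ _))
    (mix p (𝔼 ps (λ v → F (true ∷ v))) (𝔼 ps (λ v → G (true ∷ v))) (𝔼 ps (λ v → F (false ∷ v))) (𝔼 ps (λ v → G (false ∷ v))))
    where
    mix : ∀ p a b c d → p * (a + b) + (1ℚ - p) * (c + d) ≡ p * a + (1ℚ - p) * c + (p * b + (1ℚ - p) * d)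
    mix = solve-∀ ℚ-ring

  𝔼-* : ∀ {n} (ps : Vec ℚ n) c F → 𝔼 ps (λ v → c * F v) ≡ c * 𝔼 ps F
  𝔼-* []       c F = refl
  𝔼-* (p ∷ ps) c F = trans
    (cong₂ (λ x y → p * x + (1ℚ - p) * y) (𝔼-* ps c _) (𝔼-* ps c _))
    (mix p c (𝔼 ps (λ v → F (true ∷ v))) (𝔼 ps (λ v → F (false ∷ v))))
    where
    mix : ∀ p c a b → p * (c * a) + (1ℚ - p) * (c * b) ≡ c * (p * a + (1ℚ - p) * b)
    mix = solve-∀ ℚ-ring

  𝔼-complement : ∀ {n} (ps : Vec ℚ n) (B : Vec Bool n → Bool) →
    𝔼 ps (λ v → ⟦ B v ⟧) + 𝔼 ps (λ v → ⟦ not (B v) ⟧) ≡ 1ℚ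
  𝔼-complement ps B = trans (sym (𝔼-+ ps _ _)) (trans (𝔼-cong ps (λ v → total (B v))) (𝔼-const ps 1ℚ))
    where
    total : ∀ b → ⟦ b ⟧ + ⟦ not b ⟧ ≡ 1ℚ
    total true  = refl
    total false = refl

  𝔼-split : ∀ {n} (ps : Vec ℚ n) i F →
    𝔼 ps F ≡ lookup ps i * 𝔼 (ps [ i ]≔ 1ℚ) F + (1ℚ - lookup ps i) * 𝔼 (ps [ i ]≔ 0ℚ) F
  𝔼-split (p ∷ ps) zero    F = split p (𝔼 ps (λ v → F (true ∷ v))) (𝔼 ps (λ v → F (false ∷ v)))
    where
    split : ∀ p a b → p * a + (1ℚ - p) * b ≡
      p * (1ℚ * a + (1ℚ - 1ℚ) * b) + (1ℚ - p) * (0ℚ * a + (1ℚ - 0ℚ) * b)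
    split = solve-∀ ℚ-ring
  𝔼-split (p ∷ ps) (suc i) F = trans
    (cong₂ (λ x y → p * x + (1ℚ - p) * y) (𝔼-split ps i (λ v → F (true ∷ v))) (𝔼-split ps i (λ v → F (false ∷ v))))
    (interchange p (lookup ps i) (𝔼 (ps [ i ]≔ 1ℚ) (λ v → F (true ∷ v))) (𝔼 (ps [ i ]≔ 0ℚ) (λ v → F (true ∷ v)))
      (𝔼 (ps [ i ]≔ 1ℚ) (λ v → F (false ∷ v))) (𝔼 (ps [ i ]≔ 0ℚ) (λ v → F (false ∷ v))))
    where
    interchange : ∀ p q a b c d →
      p * (q * a + (1ℚ - q) * b) + (1ℚ - p) * (q * c + (1ℚ - q) * d) ≡
      q * (p * a + (1ℚ - p) * c) + (1ℚ - q) * (p * b + (1ℚ - p) * d)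
    interchange = solve-∀ ℚ-ring

  -- The branch in which bit i differs from b has weight zero, so F and G may disagree there.
  𝔼-determined : ∀ {n} (ps : Vec ℚ n) i b {F G} → lookup ps i ≡ ⟦ b ⟧ →
    (∀ v → lookup v i ≡ b → F v ≡ G v) → 𝔼 ps F ≡ 𝔼 ps G
  𝔼-determined (_ ∷ ps) zero true {F} {G} refl F≗G = trans
    (cong (λ x → 1ℚ * x + (1ℚ - 1ℚ) * 𝔼 ps (λ v → F (false ∷ v))) (𝔼-cong ps (λ v → F≗G (true ∷ v) refl)))
    (irrelevant (𝔼 ps (λ v → G (true ∷ v))) (𝔼 ps (λ v → F (false ∷ v))) (𝔼 ps (λ v → G (false ∷ v))))
    where
    irrelevant : ∀ a b c → 1ℚ * a + (1ℚ - 1ℚ) * b ≡ 1ℚ * a + (1ℚ - 1ℚ) * c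
    irrelevant = solve-∀ ℚ-ring
  𝔼-determined (_ ∷ ps) zero false {F} {G} refl F≗G = trans
    (cong (λ x → 0ℚ * 𝔼 ps (λ v → F (true ∷ v)) + (1ℚ - 0ℚ) * x) (𝔼-cong ps (λ v → F≗G (false ∷ v) refl)))
    (irrelevant (𝔼 ps (λ v → G (false ∷ v))) (𝔼 ps (λ v → F (true ∷ v))) (𝔼 ps (λ v → G (true ∷ v))))
    where
    irrelevant : ∀ a b c → 0ℚ * b + (1ℚ - 0ℚ) * a ≡ 0ℚ * c + (1ℚ - 0ℚ) * a
    irrelevant = solve-∀ ℚ-ring
  𝔼-determined (p ∷ ps) (suc i) b eq F≗G = cong₂ (λ x y → p * x + (1ℚ - p) * y)
    (𝔼-determined ps i b eq (λ v → F≗G (true ∷ v))) (𝔼-determined ps i b eq (λ v → F≗G (false ∷ v)))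

-- A theorem of the alternative for integer cones

module Alternatives {X : Set} (comb : ℕ → X → ℕ → X → X) where
  open Z using (+_; _+_; _*_; _-_; -_; _≤_)

  Linear : (X → ℤ) → Set
  Linear φ = ∀ a x b y → φ (comb a x b y) ≡ +[1+ a ] * φ x + +[1+ b ] * φ y

  -- Both coefficients are strictly positive, as weights of trees are, so no zero vector enters the
  -- cone and a point of it is a nontrivial solution.
  data Span (G : List X) : X → Set where
    generator : ∀ {x} → x ∈ G → Span G x
    combine   : ∀ a {x} b {y} → Span G x → Span G y → Span G (comb a x b y)

  Feasible : List (X → ℤ) → X → Set
  Feasible Φ x = ∀ φ → φ ∈ Φ → 0ℤ ≤ φ x

  -- Over ℤ, `≤ -1` expresses strict negativity. The functional ψ of the dual is recorded through
  -- its sign on feasible points rather than through its coefficients in Φ, and that sign is what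
  -- refutes a primal solution.
  Primal Dual : List (X → ℤ) → List X → Set
  Primal Φ G = ∃ λ x → Span G x × Feasible Φ x
  Dual   Φ G = ∃ λ ψ → Linear ψ × (∀ x → Feasible Φ x → 0ℤ ≤ ψ x) × (∀ g → g ∈ G → ψ g ≤ -1ℤ)

  0≤+ : ∀ {i j} → 0ℤ ≤ i → 0ℤ ≤ j → 0ℤ ≤ i + j
  0≤+ = ℤₚ.+-mono-≤

  0≤* : ∀ {i j} → 0ℤ ≤ i → 0ℤ ≤ j → 0ℤ ≤ i * j
  0≤* {+ m} {+ n} _ _ = subst (0ℤ ≤_) (ℤₚ.pos-* m n) (+≤+ N.z≤n)

  0≤ℕ* : ∀ n {i} → 0ℤ ≤ i → 0ℤ ≤ + n * i
  0≤ℕ* n = 0≤* {+ n} (+≤+ N.z≤n)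

  ≤-by-diff : ∀ {i j} k → j - i ≡ k → 0ℤ ≤ k → i ≤ j
  ≤-by-diff _ refl = ℤₚ.0≤i-j⇒j≤i

  ≰-1⇒0≤ : ∀ {i} → ¬ i ≤ -1ℤ → 0ℤ ≤ i
  ≰-1⇒0≤ {+ _}      _   = +≤+ N.z≤n
  ≰-1⇒0≤ { -[1+ n ]} i≰ = contradiction (-≤- N.z≤n) i≰

  upper-bound : (φ : X → ℤ) (G : List X) → ∃ λ L → ∀ g → g ∈ G → φ g ≤ + L
  upper-bound φ []      = 0 , λ _ ()
  upper-bound φ (x ∷ G) with upper-bound φ G
  ... | L , φ≤L = ∣ φ x ∣ N.+ L , λ where
      _ (here refl)   → ℤₚ.≤-trans (i≤∣i∣ (φ x)) (+≤+ (ℕₚ.m≤m+n ∣ φ x ∣ L))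
      g (there g∈G) → ℤₚ.≤-trans (φ≤L g g∈G) (+≤+ (ℕₚ.m≤n+m L ∣ φ x ∣))
    where
    i≤∣i∣ : ∀ i → i ≤ + ∣ i ∣
    i≤∣i∣ (+ n)    = ℤₚ.≤-refl
    i≤∣i∣ -[1+ n ] = -≤+

  1≤⇒suc-pred : ∀ {i} → 1ℤ ≤ i → +[1+ N.pred ∣ i ∣ ] ≡ i
  1≤⇒suc-pred {+[1+ n ]} _ = refl
  1≤⇒suc-pred {+ zero} (+≤+ ())

  ≤-1⇒suc-pred : ∀ {i} → i ≤ -1ℤ → +[1+ N.pred ∣ i ∣ ] ≡ - i
  ≤-1⇒suc-pred { -[1+ n ]} _ = refl

  -- Fourier–Motzkin elimination of the constraint φ ≥ 0.
  module Elimination (φ : X → ℤ) (φ-linear : Linear φ) (G : List X) where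

    -- The weights |φ n| and |φ p| make φ cancel; the predecessors compensate for the successors
    -- built into `comb`.
    balance : X → X → X
    balance p n = comb (N.pred ∣ φ n ∣) p (N.pred ∣ φ p ∣) n

    eliminate : List X
    eliminate = filter (λ x → 0ℤ ℤₚ.≤? φ x) G ++
      cartesianProductWith balance (filter (λ x → 1ℤ ℤₚ.≤? φ x) G) (filter (λ x → φ x ℤₚ.≤? -1ℤ) G)

    value-balance : ∀ {ψ} → Linear ψ → ∀ {p n} → 1ℤ ≤ φ p → φ n ≤ -1ℤ →
      ψ (balance p n) ≡ - φ n * ψ p + φ p * ψ n
    value-balance {ψ} lin {p} {n} 1≤φp φn≤-1 = trans (lin _ p _ n)
      (cong₂ (λ a b → a * ψ p + b * ψ n) (≤-1⇒suc-pred φn≤-1) (1≤⇒suc-pred 1≤φp))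

    ∈-eliminate⁻ : ∀ {x} → x ∈ eliminate → Span G x × 0ℤ ≤ φ x
    ∈-eliminate⁻ x∈ with ∈-++⁻ (filter (λ x → 0ℤ ℤₚ.≤? φ x) G) x∈
    ... | inj₁ x∈f with ∈-filter⁻ (λ x → 0ℤ ℤₚ.≤? φ x) x∈f
    ...   | x∈G , 0≤φx = generator x∈G , 0≤φx
    ∈-eliminate⁻ x∈ | inj₂ x∈c with ∈-cartesianProductWith⁻ balance (filter (λ x → 1ℤ ℤₚ.≤? φ x) G) _ x∈c
    ... | p , n , p∈ , n∈ , refl with ∈-filter⁻ (λ x → 1ℤ ℤₚ.≤? φ x) p∈ | ∈-filter⁻ (λ x → φ x ℤₚ.≤? -1ℤ) n∈
    ...   | p∈G , 1≤φp | n∈G , φn≤-1 =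
      combine _ _ (generator p∈G) (generator n∈G) ,
      ℤₚ.≤-reflexive (sym (trans (value-balance {φ} φ-linear 1≤φp φn≤-1) (cancel (φ n) (φ p))))
      where
      cancel : ∀ i j → - i * j + j * i ≡ 0ℤ
      cancel = ℤ-Solver.solve-∀

    Span-eliminate⁻ : ∀ {x} → Span eliminate x → Span G x × 0ℤ ≤ φ x
    Span-eliminate⁻ (generator x∈) = ∈-eliminate⁻ x∈
    Span-eliminate⁻ (combine a {x} b {y} sx sy) with Span-eliminate⁻ sx | Span-eliminate⁻ sy
    ... | sx′ , 0≤φx | sy′ , 0≤φy = combine a b sx′ sy′ ,
      subst (0ℤ ≤_) (sym (φ-linear a x b y)) (0≤+ (0≤ℕ* (suc a) 0≤φx) (0≤ℕ* (suc b) 0≤φy))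

    lift-primal : ∀ {Φ} → Primal Φ eliminate → Primal (φ ∷ Φ) G
    lift-primal (x , sx , feas) = x , proj₁ (Span-eliminate⁻ sx) , λ where
      _ (here refl) → proj₂ (Span-eliminate⁻ sx)
      χ (there χ∈)  → feas χ χ∈

    module _ (ψ : X → ℤ) (ψ-linear : Linear ψ) (ψ<0 : ∀ g → g ∈ eliminate → ψ g ≤ -1ℤ) where

      mixture : ℕ → ℕ → X → ℤ
      mixture z m x = + z * φ x + +[1+ m ] * ψ x

      mixture-linear : ∀ z m → Linear (mixture z m)
      mixture-linear z m a x b y = trans
        (cong₂ (λ i j → + z * i + +[1+ m ] * j) (φ-linear a x b y) (ψ-linear a x b y))
        (interchange (+ z) +[1+ m ] +[1+ a ] +[1+ b ] (φ x) (φ y) (ψ x) (ψ y))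
        where
        interchange : ∀ z m a b i j k l →
          z * (a * i + b * j) + m * (a * k + b * l) ≡ a * (z * i + m * k) + b * (z * j + m * l)
        interchange = ℤ-Solver.solve-∀

      NegativeOn : List X → ℕ → ℕ → Set
      NegativeOn H z m = (∀ g → g ∈ G → 0ℤ ≤ φ g → mixture z m g ≤ -1ℤ) × (∀ h → h ∈ H → mixture z m h ≤ -1ℤ)

      ψ-nonneg : ∀ g → g ∈ G → 0ℤ ≤ φ g → ψ g ≤ -1ℤ
      ψ-nonneg g g∈G 0≤φg = ψ<0 g (∈-++⁺ˡ (∈-filter⁺ (λ x → 0ℤ ℤₚ.≤? φ x) g∈G 0≤φg))

      -- The compatibility between the upper limit that p puts on the ratio of a mixture and the
      -- lower limit that n puts on it. For φ p > 0 the balanced pair is itself a generator of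
      -- `eliminate`; for φ p = 0 the claim follows from ψ p ≤ -1, since p survives the elimination.
      ψ-pair : ∀ p n → p ∈ G → n ∈ G → 0ℤ ≤ φ p → φ n ≤ -1ℤ → - φ n * ψ p + φ p * ψ n ≤ -1ℤ
      ψ-pair p n p∈G n∈G 0≤φp φn≤-1 with 1ℤ ℤₚ.≤? φ p
      ... | yes 1≤φp = subst (_≤ -1ℤ) (value-balance {ψ} ψ-linear 1≤φp φn≤-1)
        (ψ<0 _ (∈-++⁺ʳ (filter (λ x → 0ℤ ℤₚ.≤? φ x) G) (∈-cartesianProductWith⁺ balance
          (∈-filter⁺ (λ x → 1ℤ ℤₚ.≤? φ x) p∈G 1≤φp) (∈-filter⁺ (λ x → φ x ℤₚ.≤? -1ℤ) n∈G φn≤-1))))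
      ... | no 1≰φp = ≤-by-diff _ (expand (φ n) (φ p) (ψ p) (ψ n) φp≡0)
        (0≤+ (0≤* (ℤₚ.i≤j⇒0≤j-i φn≤-1) (ℤₚ.≤-trans (+≤+ N.z≤n) (ℤₚ.neg-mono-≤ (ψ-nonneg p p∈G 0≤φp))))
             (ℤₚ.i≤j⇒0≤j-i (ψ-nonneg p p∈G 0≤φp)))
        where
        φp≡0 : φ p ≡ 0ℤ
        φp≡0 = zero-of (φ p) 0≤φp 1≰φp
          where
          zero-of : ∀ i → 0ℤ ≤ i → ¬ 1ℤ ≤ i → i ≡ 0ℤ
          zero-of (+ zero)  _ _   = refl
          zero-of +[1+ n ] _ 1≰i = contradiction (+≤+ (N.s≤s N.z≤n)) 1≰i
        expand : ∀ i j k l → j ≡ 0ℤ → -1ℤ - (- i * k + j * l) ≡ (-1ℤ - i) * (- k) + (-1ℤ - k)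
        expand i .0ℤ k l refl = expand′ i k l
          where
          expand′ : ∀ i k l → -1ℤ - (- i * k + 0ℤ * l) ≡ (-1ℤ - i) * (- k) + (-1ℤ - k)
          expand′ = ℤ-Solver.solve-∀

      -- If z/(m+1) is too small for h, replace it by a ratio slightly above ψ(h)/|φ(h)|.
      increase-ratio : ∀ H z m h → (∀ {x} → x ∈ H → x ∈ G) → h ∈ G → φ h ≤ -1ℤ → 0ℤ ≤ mixture z m h →
        NegativeOn H z m → ∃ λ z′ → ∃ λ m′ → NegativeOn (h ∷ H) z′ m′
      increase-ratio H z m h H⊆G h∈G φh≤-1 0≤mix (nonneg , negH) with upper-bound φ G
      ... | L , φ≤L = z′ , m′ , nonneg′ , λ where
          _ (here refl) → negh
          n (there n∈H) → negH′ n n∈H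
        where
        A k N : ℤ
        A = - φ h
        k = ψ h
        N = +[1+ L ]
        0≤A : 0ℤ ≤ A
        0≤A = ℤₚ.≤-trans (+≤+ N.z≤n) (ℤₚ.neg-mono-≤ φh≤-1)
        0≤k : 0ℤ ≤ k
        0≤k = ℤₚ.*-cancelˡ-≤-pos 0ℤ k +[1+ m ] (subst (_≤ +[1+ m ] * k) (sym (ℤₚ.*-zeroʳ +[1+ m ]))
          (ℤₚ.≤-trans (0≤+ 0≤mix (0≤* (+≤+ (N.z≤n {z})) 0≤A)) (ℤₚ.≤-reflexive (drop (+ z) (φ h) (+[1+ m ] * k)))))
          where
          drop : ∀ z f y → z * f + y + z * (- f) ≡ y
          drop = ℤ-Solver.solve-∀
        -- The ratio is k/A + 1/(N·A). At h the mixture collapses to φ h. At g with φ g ≥ 0 it is N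
        -- times the quantity of `ψ-pair` plus φ g, hence at most -N + L = -1, which is why N is L +
        -- 1.
        z′ m′ : ℕ
        z′ = suc (suc L N.* ∣ k ∣)
        m′ = N.pred (suc L N.* ∣ φ h ∣)
        ∣∣-nonneg : ∀ {i} → 0ℤ ≤ i → + ∣ i ∣ ≡ i
        ∣∣-nonneg {+ _} _ = refl
        z′≡ : + z′ ≡ 1ℤ + N * k
        z′≡ = cong (λ i → 1ℤ + i) (trans (ℤₚ.pos-* (suc L) ∣ k ∣) (cong (N *_) (∣∣-nonneg 0≤k)))
        m′≡ : +[1+ m′ ] ≡ N * A
        m′≡ = negative (φ h) φh≤-1
          where
          negative : ∀ i → i ≤ -1ℤ → +[1+ N.pred (suc L N.* ∣ i ∣) ] ≡ N * - i
          negative -[1+ n ] _ = refl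
        mixture′ : ∀ x → mixture z′ m′ x ≡ (1ℤ + N * k) * φ x + N * A * ψ x
        mixture′ x = cong₂ (λ i j → i * φ x + j * ψ x) z′≡ m′≡
        0≤N : 0ℤ ≤ N
        0≤N = +≤+ N.z≤n
        nonneg′ : ∀ g → g ∈ G → 0ℤ ≤ φ g → mixture z′ m′ g ≤ -1ℤ
        nonneg′ g g∈G 0≤φg = subst (_≤ -1ℤ) (sym (mixture′ g)) (≤-by-diff _
          (expand (+ L) k (φ g) (φ h) (ψ g))
          (0≤+ (0≤* 0≤N (ℤₚ.i≤j⇒0≤j-i (ψ-pair g h g∈G h∈G 0≤φg φh≤-1))) (ℤₚ.i≤j⇒0≤j-i (φ≤L g g∈G))))
          where
          expand : ∀ L k f h p → -1ℤ - ((1ℤ + (1ℤ + L) * k) * f + (1ℤ + L) * - h * p) ≡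
            (1ℤ + L) * (-1ℤ - (- h * p + f * k)) + (L - f)
          expand = ℤ-Solver.solve-∀
        negh : mixture z′ m′ h ≤ -1ℤ
        negh = subst (_≤ -1ℤ) (sym (trans (mixture′ h) (collapse N k (φ h)))) φh≤-1
          where
          collapse : ∀ N k f → (1ℤ + N * k) * f + N * - f * k ≡ f
          collapse = ℤ-Solver.solve-∀
        negH′ : ∀ n → n ∈ H → mixture z′ m′ n ≤ -1ℤ
        negH′ n n∈H with 0ℤ ℤₚ.≤? φ n
        ... | yes 0≤φn = nonneg′ n (H⊆G n∈H) 0≤φn
        ... | no  0≰φn = subst (_≤ -1ℤ) (sym (mixture′ n)) (≤-by-diff _
          (expand N k (φ n) (φ h) (ψ n)) (0≤+ (0≤* 0≤N slope) (ℤₚ.i≤j⇒0≤j-i φn≤-1)))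
          where
          φn≤-1 : φ n ≤ -1ℤ
          φn≤-1 = ℤₚ.i<j⇒i≤pred[j] (ℤₚ.≰⇒> 0≰φn)
          0≤-φn : 0ℤ ≤ - φ n
          0≤-φn = ℤₚ.≤-trans (+≤+ N.z≤n) (ℤₚ.neg-mono-≤ φn≤-1)
          expand : ∀ N k f h p → -1ℤ - ((1ℤ + N * k) * f + N * - h * p) ≡
            N * (k * - f - - h * p) + (-1ℤ - f)
          expand = ℤ-Solver.solve-∀
          0≤-mix : 0ℤ ≤ - mixture z m n
          0≤-mix = ℤₚ.≤-trans (+≤+ N.z≤n) (ℤₚ.neg-mono-≤ (negH n n∈H))
          -- The old ratio was large enough for n but too small for h, so the lower limit set by n
          -- lies below k/A, and the new ratio passes it as well.
          slope : 0ℤ ≤ k * - φ n - A * ψ n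
          slope = ℤₚ.*-cancelˡ-≤-pos 0ℤ _ +[1+ m ] (subst₂ _≤_ (sym (ℤₚ.*-zeroʳ +[1+ m ]))
            (cross (+ z) +[1+ m ] (φ n) (φ h) k (ψ n)) (0≤+ (0≤* 0≤-φn 0≤mix) (0≤* 0≤A 0≤-mix)))
            where
            cross : ∀ z m f h k p → - f * (z * h + m * k) + - h * - (z * f + m * p) ≡ m * (k * - f - - h * p)
            cross = ℤ-Solver.solve-∀

      -- Only the ratio z/(m+1) matters. Generators with φ > 0 limit it from above, those with φ < 0
      -- from below. It starts at 0 and is raised along H just past each violated lower limit;
      -- `ψ-pair` keeps it under the upper ones.
      negative-mixture : ∀ H → (∀ {x} → x ∈ H → x ∈ G) → ∃ λ z → ∃ λ m → NegativeOn H z m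
      negative-mixture [] _ = 0 , 0 , (λ g g∈G 0≤φg → subst (_≤ -1ℤ) (sym (only-ψ (φ g) (ψ g))) (ψ-nonneg g g∈G 0≤φg)) , λ _ ()
        where
        only-ψ : ∀ i j → 0ℤ * i + 1ℤ * j ≡ j
        only-ψ = ℤ-Solver.solve-∀
      negative-mixture (h ∷ H) H⊆G with negative-mixture H (λ x∈H → H⊆G (there x∈H))
      ... | z , m , nonneg , negH with 0ℤ ℤₚ.≤? φ h | mixture z m h ℤₚ.≤? -1ℤ
      ...   | yes 0≤φh | _       = z , m , nonneg , λ where
        _ (here refl) → nonneg h (H⊆G (here refl)) 0≤φh
        n (there n∈H) → negH n n∈H
      ...   | no _     | yes neg = z , m , nonneg , λ where
        _ (here refl) → neg
        n (there n∈H) → negH n n∈H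
      ...   | no 0≰φh  | no ¬neg = increase-ratio H z m h (λ x∈H → H⊆G (there x∈H)) (H⊆G (here refl))
        (ℤₚ.i<j⇒i≤pred[j] (ℤₚ.≰⇒> 0≰φh)) (≰-1⇒0≤ ¬neg) (nonneg , negH)

    lift-dual : ∀ {Φ} → Dual Φ eliminate → Dual (φ ∷ Φ) G
    lift-dual (ψ , ψ-linear , ψ≥0 , ψ<0) with negative-mixture ψ ψ-linear ψ<0 G (λ x∈ → x∈)
    ... | z , m , _ , neg = mixture ψ ψ-linear ψ<0 z m , mixture-linear ψ ψ-linear ψ<0 z m ,
      (λ x feas → 0≤+ (0≤ℕ* z (feas φ (here refl)))
                      (0≤ℕ* (suc m) (ψ≥0 x (λ χ χ∈ → feas χ (there χ∈))))) , neg

  alternatives : ∀ Φ → (∀ φ → φ ∈ Φ → Linear φ) → ∀ G → Primal Φ G ⊎ Dual Φ G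
  alternatives [] _ []      = inj₂ ((λ _ → 0ℤ) , vanish , (λ _ _ → ℤₚ.≤-refl) , λ _ ())
    where
    vanish : ∀ a x b y → 0ℤ ≡ +[1+ a ] * 0ℤ + +[1+ b ] * 0ℤ
    vanish a _ b _ = sym (cong₂ _+_ (ℤₚ.*-zeroʳ +[1+ a ]) (ℤₚ.*-zeroʳ +[1+ b ]))
  alternatives [] _ (g ∷ _) = inj₁ (g , generator (here refl) , λ _ ())
  alternatives (φ ∷ Φ) linear G with alternatives Φ (λ χ χ∈ → linear χ (there χ∈)) (Elimination.eliminate φ (linear φ (here refl)) G)
  ... | inj₁ primal = inj₁ (Elimination.lift-primal φ (linear φ (here refl)) G primal)
  ... | inj₂ dual   = inj₂ (Elimination.lift-dual φ (linear φ (here refl)) G dual)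

-- Decision trees and their finite distributions

-- Inputs are functions. Respecting pointwise equality lets the finitely many tabulated bit vectors
-- stand for all inputs, so that correctness becomes a finite list of constraints.
Extensional : ∀ {n} → PartialFn n → Set
Extensional f = ∀ {x y} → x ≗ y → f x ≡ f y

module DecisionTrees where
  open N using (_+_; _*_; _≤_; _⊔_)

  eval-cong : ∀ {n} (t : DT n) {x y} → x ≗ y → eval t x ≡ eval t y
  eval-cong (leaf b) x≗y = refl
  eval-cong (node i l r) {x} {y} x≗y rewrite x≗y i with y i
  ... | true  = eval-cong r x≗y
  ... | false = eval-cong l x≗y

  query : ∀ {n m} → Vec (Fin n) m → (Vec Bool m → DT n) → DT n
  query []       k = k []
  query (i ∷ is) k = node i (query is (λ v → k (false ∷ v))) (query is (λ v → k (true ∷ v)))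

  eval-query : ∀ {n m} (is : Vec (Fin n) m) k x → eval (query is k) x ≡ eval (k (Vec.map x is)) x
  eval-query []       k x = refl
  eval-query (i ∷ is) k x with x i
  ... | true  = eval-query is (λ v → k (true ∷ v)) x
  ... | false = eval-query is (λ v → k (false ∷ v)) x

  depth-query : ∀ {n m} (is : Vec (Fin n) m) {k d} → (∀ v → depth (k v) ≤ d) → depth (query is k) ≤ m + d
  depth-query []       ≤d = ≤d []
  depth-query (i ∷ is) ≤d = N.s≤s (ℕₚ.⊔-lub (depth-query is (λ v → ≤d (false ∷ v))) (depth-query is (λ v → ≤d (true ∷ v))))

  weightOutputting-cong : ∀ {n} (D : RDT n) {x y} b → x ≗ y → weightOutputting D x b ≡ weightOutputting D y b
  weightOutputting-cong []            b x≗y = refl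
  weightOutputting-cong ((w , t) ∷ D) b x≗y = cong₂ (λ c W → (if does (c ≟ b) then suc w else 0) + W)
    (eval-cong t x≗y) (weightOutputting-cong D b x≗y)

  totalWeight-++ : ∀ {n} (D D′ : RDT n) → totalWeight (D ++ D′) ≡ totalWeight D + totalWeight D′
  totalWeight-++ []            D′ = refl
  totalWeight-++ ((w , _) ∷ D) D′ = trans (cong (λ T → suc w + T) (totalWeight-++ D D′))
    (sym (ℕₚ.+-assoc (suc w) (totalWeight D) (totalWeight D′)))

  weightOutputting-++ : ∀ {n} (D D′ : RDT n) x b →
    weightOutputting (D ++ D′) x b ≡ weightOutputting D x b + weightOutputting D′ x b
  weightOutputting-++ []            D′ x b = refl
  weightOutputting-++ ((w , t) ∷ D) D′ x b = trans (cong (λ W → here-weight + W) (weightOutputting-++ D D′ x b))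
    (sym (ℕₚ.+-assoc here-weight (weightOutputting D x b) (weightOutputting D′ x b)))
    where
    here-weight : ℕ
    here-weight = if does (eval t x ≟ b) then suc w else 0

  cost-++ : ∀ {n r} (D D′ : RDT n) → cost D ≤ r → cost D′ ≤ r → cost (D ++ D′) ≤ r
  cost-++ []            D′ _  ≤r′ = ≤r′
  cost-++ ((_ , t) ∷ D) D′ ≤r ≤r′ = ℕₚ.⊔-lub (ℕₚ.m⊔n≤o⇒m≤o (depth t) (cost D) ≤r)
    (cost-++ D D′ (ℕₚ.m⊔n≤o⇒n≤o (depth t) (cost D) ≤r) ≤r′)

  -- Weights are stored as predecessors, so this multiplies every weight by (suc a).
  scale : ∀ {n} → ℕ → RDT n → RDT n
  scale a = map λ (w , t) → w + a * suc w , t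

  totalWeight-scale : ∀ {n} a (D : RDT n) → totalWeight (scale a D) ≡ suc a * totalWeight D
  totalWeight-scale a []            = sym (ℕₚ.*-zeroʳ a)
  totalWeight-scale a ((w , _) ∷ D) = trans (cong (λ T → suc a * suc w + T) (totalWeight-scale a D))
    (sym (ℕₚ.*-distribˡ-+ (suc a) (suc w) (totalWeight D)))

  weightOutputting-scale : ∀ {n} a (D : RDT n) x b → weightOutputting (scale a D) x b ≡ suc a * weightOutputting D x b
  weightOutputting-scale a []            x b = sym (ℕₚ.*-zeroʳ a)
  weightOutputting-scale a ((w , t) ∷ D) x b = trans
    (cong₂ _+_ (if-scale (does (eval t x ≟ b))) (weightOutputting-scale a D x b))
    (sym (ℕₚ.*-distribˡ-+ (suc a) (if does (eval t x ≟ b) then suc w else 0) (weightOutputting D x b)))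
    where
    if-scale : ∀ c → (if c then suc (w + a * suc w) else 0) ≡ suc a * (if c then suc w else 0)
    if-scale true  = refl
    if-scale false = sym (ℕₚ.*-zeroʳ a)

  cost-scale : ∀ {n} a (D : RDT n) → cost (scale a D) ≡ cost D
  cost-scale a []            = refl
  cost-scale a ((_ , t) ∷ D) = cong (depth t ⊔_) (cost-scale a D)

  scale-0 : ∀ {n} (D : RDT n) → scale 0 D ≡ D
  scale-0 []            = refl
  scale-0 ((w , t) ∷ D) = cong₂ (λ w D → (w , t) ∷ D) (ℕₚ.+-identityʳ w) (scale-0 D)

  mixTrees : ∀ {n} → ℕ → RDT n → ℕ → RDT n → RDT n
  mixTrees a D b D′ = scale a D ++ scale b D′

  leaves : ∀ {n} → List (DT n)
  leaves = leaf true ∷ leaf false ∷ []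

  nodeOf : ∀ {n} → Fin n → DT n × DT n → DT n
  nodeOf i (s , t) = node i s t

  trees : ∀ {n} → ℕ → List (DT n)
  trees zero    = leaves
  trees {n} (suc r) = leaves ++
    cartesianProductWith nodeOf (List.allFin n) (cartesianProduct (trees r) (trees r))

  ∈-leaves : ∀ {n} b → leaf {n} b ∈ leaves
  ∈-leaves true  = here refl
  ∈-leaves false = there (here refl)

  ∈-trees⁺ : ∀ {n} r (t : DT n) → depth t ≤ r → t ∈ trees r
  ∈-trees⁺ zero    (leaf b)     _           = ∈-leaves b
  ∈-trees⁺ (suc r) (leaf b)     _           = ∈-++⁺ˡ (∈-leaves b)
  ∈-trees⁺ (suc r) (node i s t) (N.s≤s ≤r) = ∈-++⁺ʳ leaves (∈-cartesianProductWith⁺ nodeOf (∈-allFin i)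
    (∈-cartesianProduct⁺ (∈-trees⁺ r s (ℕₚ.m⊔n≤o⇒m≤o (depth s) (depth t) ≤r)) (∈-trees⁺ r t (ℕₚ.m⊔n≤o⇒n≤o (depth s) (depth t) ≤r))))

  ∈-leaves⁻ : ∀ {n r} {t : DT n} → t ∈ leaves → depth t ≤ r
  ∈-leaves⁻ (here refl)         = N.z≤n
  ∈-leaves⁻ (there (here refl)) = N.z≤n

  ∈-trees⁻ : ∀ {n} r {t : DT n} → t ∈ trees r → depth t ≤ r
  ∈-trees⁻ zero t∈ = ∈-leaves⁻ t∈
  ∈-trees⁻ (suc r) t∈ with ∈-++⁻ leaves t∈
  ... | inj₁ t∈l = ∈-leaves⁻ t∈l
  ... | inj₂ t∈n with ∈-cartesianProductWith⁻ nodeOf (List.allFin _) (cartesianProduct (trees r) (trees r)) t∈n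
  ...   | i , (s , u) , _ , su∈ , refl with ∈-cartesianProduct⁻ (trees r) (trees r) su∈
  ...     | s∈ , u∈ = N.s≤s (ℕₚ.⊔-lub (∈-trees⁻ r s∈) (∈-trees⁻ r u∈))

  allVecs : ∀ n → List (Vec Bool n)
  allVecs zero    = [] ∷ []
  allVecs (suc n) = map (true ∷_) (allVecs n) ++ map (false ∷_) (allVecs n)

  ∈-allVecs : ∀ {n} (v : Vec Bool n) → v ∈ allVecs n
  ∈-allVecs []          = here refl
  ∈-allVecs (true  ∷ v) = ∈-++⁺ˡ (∈-map⁺ (true ∷_) (∈-allVecs v))
  ∈-allVecs (false ∷ v) = ∈-++⁺ʳ (map (true ∷_) (allVecs _)) (∈-map⁺ (false ∷_) (∈-allVecs v))

-- The minimum defining R is attained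

module RandomizedComplexity where
  open DecisionTrees
  open N using (_+_; _*_; _≤_; _⊔_)
  open Z using (+_)

  -- Error at most 1/3 at x, cleared of denominators so that it is linear in the weights. Inputs
  -- outside the domain give the constraint 0 ≥ 0.
  slack : ∀ {n} → Input n → Maybe Bool → RDT n → ℤ
  slack x nothing  D = 0ℤ
  slack x (just b) D = + (3 * weightOutputting D x b) Z.- + (2 * totalWeight D)

  module _ {n : ℕ} where
    open Alternatives (mixTrees {n})

    slack-linear : ∀ x mb → Linear (slack x mb)
    slack-linear x nothing a D b D′ = sym (cong₂ Z._+_ (ℤₚ.*-zeroʳ +[1+ a ]) (ℤₚ.*-zeroʳ +[1+ b ]))
    slack-linear x (just c) a D b D′
      rewrite weightOutputting-++ (scale a D) (scale b D′) x c | weightOutputting-scale a D x c | weightOutputting-scale b D′ x c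
            | totalWeight-++ (scale a D) (scale b D′) | totalWeight-scale a D | totalWeight-scale b D′
            = trans (cong₂ Z._-_ (pos-combination 3 W W′) (pos-combination 2 T T′))
                (regroup +[1+ a ] +[1+ b ] (+ (3 * W)) (+ (3 * W′)) (+ (2 * T)) (+ (2 * T′)))
      where
      W W′ T T′ : ℕ
      W  = weightOutputting D x c
      W′ = weightOutputting D′ x c
      T  = totalWeight D
      T′ = totalWeight D′
      rearrange : ∀ k a b u v → k * (a * u + b * v) ≡ a * (k * u) + b * (k * v)
      rearrange = ℕ-Solver.solve-∀
      pos-combination : ∀ k u v → + (k * (suc a * u + suc b * v)) ≡ +[1+ a ] Z.* + (k * u) Z.+ +[1+ b ] Z.* + (k * v)
      pos-combination k u v = trans (cong +_ (rearrange k (suc a) (suc b) u v))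
        (cong₂ Z._+_ (ℤₚ.pos-* (suc a) (k * u)) (ℤₚ.pos-* (suc b) (k * v)))
      regroup : ∀ a b i j k l → (a Z.* i Z.+ b Z.* j) Z.- (a Z.* k Z.+ b Z.* l) ≡ a Z.* (i Z.- k) Z.+ b Z.* (j Z.- l)
      regroup = ℤ-Solver.solve-∀

    singletons : ℕ → List (RDT n)
    singletons r = map (λ t → (0 , t) ∷ []) (trees r)

    Span-cost : ∀ {r D} → Span (singletons r) D → cost D ≤ r × 0 N.< totalWeight D
    Span-cost {r} (generator D∈) with ∈-map⁻ (λ t → (0 , t) ∷ []) D∈
    ... | t , t∈ , refl = ℕₚ.⊔-lub (∈-trees⁻ r t∈) N.z≤n , N.s≤s N.z≤n
    Span-cost {r} (combine a {D} b {D′} sD sD′) with Span-cost sD | Span-cost sD′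
    ... | cD , wD | cD′ , _ =
      cost-++ (scale a D) (scale b D′) (subst (_≤ r) (sym (cost-scale a D)) cD) (subst (_≤ r) (sym (cost-scale b D′)) cD′) ,
      subst (0 N.<_) (sym (trans (totalWeight-++ (scale a D) (scale b D′)) (cong (_+ totalWeight (scale b D′)) (totalWeight-scale a D))))
        (ℕₚ.≤-trans wD (ℕₚ.≤-trans (ℕₚ.m≤m+n (totalWeight D) (a * totalWeight D)) (ℕₚ.m≤m+n (suc a * totalWeight D) _)))

    module _ {r} {ψ : RDT n → ℤ} (ψ-linear : Linear ψ) (ψ<0 : ∀ D → D ∈ singletons r → ψ D Z.≤ -1ℤ) where

      -- Mixing the empty list with itself gives the empty list again, so linearity yields ψ [] =
      -- 2·ψ [].
      ψ-[] : ψ [] ≡ 0ℤ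
      ψ-[] = idempotent (ψ []) (ψ-linear 0 [] 0 [])
        where
        shift : ∀ i → (1ℤ Z.* i Z.+ 1ℤ Z.* i) Z.- i ≡ i
        shift = ℤ-Solver.solve-∀
        idempotent : ∀ i → i ≡ 1ℤ Z.* i Z.+ 1ℤ Z.* i → i ≡ 0ℤ
        idempotent i eq = trans (sym (shift i)) (trans (cong (Z._- i) (sym eq)) (ℤₚ.+-inverseʳ i))

      ψ-∷ : ∀ w t D → ψ ((w , t) ∷ D) ≡ +[1+ w ] Z.* ψ ((0 , t) ∷ []) Z.+ ψ D
      ψ-∷ w t D = trans (cong ψ (cong₂ (λ w D → (w , t) ∷ D) (sym (ℕₚ.*-identityʳ w)) (sym (scale-0 D))))
        (trans (ψ-linear w ((0 , t) ∷ []) 0 D) (cong (λ i → +[1+ w ] Z.* ψ ((0 , t) ∷ []) Z.+ i) (ℤₚ.*-identityˡ (ψ D))))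

      ψ-∷-neg : ∀ w t D → cost ((w , t) ∷ D) ≤ r → ψ D Z.≤ 0ℤ → ψ ((w , t) ∷ D) Z.≤ -1ℤ
      ψ-∷-neg w t D ≤r ψD≤0 = subst (Z._≤ -1ℤ) (sym (ψ-∷ w t D))
        (≤-by-diff _ (expand (+ w) (ψ ((0 , t) ∷ [])) (ψ D))
          (0≤+ (0≤ℕ* (suc w) (ℤₚ.i≤j⇒0≤j-i ψt<0)) (0≤+ (+≤+ (N.z≤n {w})) (ℤₚ.neg-mono-≤ ψD≤0))))
        where
        ψt<0 : ψ ((0 , t) ∷ []) Z.≤ -1ℤ
        ψt<0 = ψ<0 _ (∈-map⁺ (λ t → (0 , t) ∷ []) (∈-trees⁺ r t (ℕₚ.m⊔n≤o⇒m≤o (depth t) (cost D) ≤r)))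
        expand : ∀ w i j → -1ℤ Z.- ((1ℤ Z.+ w) Z.* i Z.+ j) ≡ (1ℤ Z.+ w) Z.* (-1ℤ Z.- i) Z.+ (w Z.+ Z.- j)
        expand = ℤ-Solver.solve-∀

      ψ-nonpos : ∀ D → cost D ≤ r → ψ D Z.≤ 0ℤ
      ψ-nonpos []            _  = ℤₚ.≤-reflexive ψ-[]
      ψ-nonpos ((w , t) ∷ D) ≤r = ℤₚ.≤-trans
        (ψ-∷-neg w t D ≤r (ψ-nonpos D (ℕₚ.m⊔n≤o⇒n≤o (depth t) (cost D) ≤r))) -≤+

      -- The dual only speaks of single trees. Peeling off the head of D writes ψ D as a positive
      -- combination of such values, so ψ is negative on every nonempty distribution of cost at most
      -- r; a correct one would make it nonnegative.
      ψ-neg : ∀ D → cost D ≤ r → 0 N.< totalWeight D → ψ D Z.≤ -1ℤ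
      ψ-neg ((w , t) ∷ D) ≤r _ = ψ-∷-neg w t D ≤r (ψ-nonpos D (ℕₚ.m⊔n≤o⇒n≤o (depth t) (cost D) ≤r))

    module _ (f : PartialFn n) (f-ext : Extensional f) where

      constraints : List (RDT n → ℤ)
      constraints = map (λ v → slack (lookup v) (f (lookup v))) (allVecs n)

      constraints-linear : ∀ φ → φ ∈ constraints → Linear φ
      constraints-linear φ φ∈ with ∈-map⁻ (λ v → slack (lookup v) (f (lookup v))) φ∈
      ... | v , _ , refl = slack-linear (lookup v) (f (lookup v))

      feasible⇒computes : ∀ {D} → 0 N.< totalWeight D → Feasible constraints D → Computes D f
      feasible⇒computes {D} 0<w feas = 0<w , λ x b fx≡b →
        let v = tabulate x
            x≗v = λ i → sym (Vecₚ.lookup∘tabulate x i)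
            0≤s = feas _ (∈-map⁺ (λ v → slack (lookup v) (f (lookup v))) (∈-allVecs v))
            0≤s′ = subst (λ mb → 0ℤ Z.≤ slack (lookup v) mb D) (trans (sym (f-ext x≗v)) fx≡b) 0≤s
        in subst (λ W → 2 * totalWeight D ≤ 3 * W) (sym (weightOutputting-cong D b x≗v)) (ℤₚ.drop‿+≤+ (ℤₚ.0≤i-j⇒j≤i 0≤s′))

      computes⇒feasible : ∀ {D} → Computes D f → Feasible constraints D
      computes⇒feasible {D} (_ , correct) φ φ∈ with ∈-map⁻ (λ v → slack (lookup v) (f (lookup v))) φ∈
      ... | v , _ , refl = nonneg (f (lookup v)) refl
        where
        nonneg : ∀ mb → f (lookup v) ≡ mb → 0ℤ Z.≤ slack (lookup v) mb D
        nonneg nothing  _  = ℤₚ.≤-refl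
        nonneg (just b) eq = ℤₚ.i≤j⇒0≤j-i (+≤+ (correct (lookup v) b eq))

      Solvable : ℕ → Set
      Solvable r = ∃ λ D → Computes D f × cost D ≤ r

      solvable? : ∀ r → Dec (Solvable r)
      solvable? r with alternatives constraints constraints-linear (singletons r)
      ... | inj₁ (D , span , feas) = yes (D , feasible⇒computes (proj₂ (Span-cost {r} span)) feas , proj₁ (Span-cost {r} span))
      ... | inj₂ (ψ , ψ-linear , ψ≥0 , ψ<0) = no λ (D , comp , ≤r) →
        contradiction (ℤₚ.≤-trans (ψ≥0 D (computes⇒feasible comp)) (ψ-neg ψ-linear ψ<0 D ≤r (proj₁ comp))) λ ()

      lookup-table : Solvable n
      lookup-table = ((0 , t) ∷ []) , (N.s≤s N.z≤n , correct) ,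
        ℕₚ.⊔-lub (subst (depth t ≤_) (ℕₚ.+-identityʳ n) (depth-query (allFin n) (λ _ → N.z≤n))) N.z≤n
        where
        -- The default `false` is harmless: correctness is tested only where f is `just`.
        answer : Vec Bool n → Bool
        answer v = fromMaybe false (f (lookup v))
        t : DT n
        t = query (allFin n) (λ v → leaf (answer v))
        eval-t : ∀ x b → f x ≡ just b → eval t x ≡ b
        eval-t x b eq = trans (eval-query (allFin n) (λ v → leaf (answer v)) x) (trans
          (cong answer (sym (Vecₚ.tabulate-allFin x)))
          (cong (fromMaybe false) (trans (f-ext (Vecₚ.lookup∘tabulate x)) eq)))
        correct : ∀ x b → f x ≡ just b → 2 * 1 ≤ 3 * weightOutputting ((0 , t) ∷ []) x b
        correct x b eq rewrite eval-t x b eq with b ≟ b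
        ... | yes _  = N.s≤s (N.s≤s N.z≤n)
        ... | no b≢b = contradiction refl b≢b

      -- The search runs downwards from a solvable bound. Since `Solvable` bounds the cost by ≤, the
      -- first failure rules out all smaller costs at once.
      least : ∀ r → Solvable r → ∃ (IsR f)
      least zero    s = 0 , s , λ _ _ → N.z≤n
      least (suc r) s with solvable? r
      ... | yes s′ = least r s′
      ... | no  ¬s = suc r , s , λ D comp → ℕₚ.≰⇒> λ ≤r → ¬s (D , comp , ≤r)

      abstract
        R-exists : ∃ (IsR f)
        R-exists = least n lookup-table

-- Correlation with a fixed vector and Chebyshev's inequality

module Concentration where
  open OrderedField
  open Expectation
  open Q using (_+_; _*_; _-_; -_; _≤_; _<_)

  same : Bool → Bool → Bool
  same true  b = b
  same false b = not b

  agreements disagreements : ∀ {n} → Vec Bool n → Vec Bool n → ℕ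
  agreements []       []       = 0
  agreements (a ∷ as) (b ∷ bs) = if same a b then suc (agreements as bs) else agreements as bs
  disagreements []       []       = 0
  disagreements (a ∷ as) (b ∷ bs) = if same a b then disagreements as bs else suc (disagreements as bs)

  Close : ∀ {n} → ℕ → Vec Bool n → Vec Bool n → Set
  Close t a b = disagreements a b N.+ t N.≤ agreements a b

  close? : ∀ {n} t (a b : Vec Bool n) → Dec (Close t a b)
  close? t a b = disagreements a b N.+ t ℕₚ.≤? agreements a b

  close : ∀ {n} → ℕ → Vec Bool n → Vec Bool n → Bool
  close t a b = does (close? t a b)

  sgn : Bool → ℚ
  sgn true  = 1ℚ
  sgn false = - 1ℚ

  correlation : ∀ {n} → Vec Bool n → Vec Bool n → ℚ
  correlation a b = ι (agreements a b) - ι (disagreements a b)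

  correlation-∷ : ∀ {n} a b (as bs : Vec Bool n) →
    correlation (a ∷ as) (b ∷ bs) ≡ sgn (same a b) + correlation as bs
  correlation-∷ a b as bs with same a b
  ... | true  = shift (ι (agreements as bs)) (ι (disagreements as bs))
    where
    shift : ∀ x y → 1ℚ + x - y ≡ 1ℚ + (x - y)
    shift = solve-∀ ℚ-ring
  ... | false = shift (ι (agreements as bs)) (ι (disagreements as bs))
    where
    shift : ∀ x y → x - (1ℚ + y) ≡ - 1ℚ + (x - y)
    shift = solve-∀ ℚ-ring

  -- The expectation of `sgn (same a b)` when b is true with probability p.
  drift : Bool → ℚ → ℚ
  drift true  p = p + p - 1ℚ
  drift false p = 1ℚ - (p + p)

  mean : ∀ {n} → Vec Bool n → Vec ℚ n → ℚ
  mean []       []       = 0ℚ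
  mean (a ∷ as) (p ∷ ps) = drift a p + mean as ps

  mean-lower : ∀ {n γ} (a : Vec Bool n) ps → (∀ i → γ ≤ drift (lookup a i) (lookup ps i)) → ι n * γ ≤ mean a ps
  mean-lower {γ = γ} []       []       _  = ℚₚ.≤-reflexive (ℚₚ.*-zeroˡ γ)
  mean-lower {suc n} {γ} (a ∷ as) (p ∷ ps) γ≤ = subst (_≤ drift a p + mean as ps) (sym (unfold (ι n) γ))
    (ℚₚ.+-mono-≤ (γ≤ zero) (mean-lower as ps (λ i → γ≤ (suc i))))
    where
    unfold : ∀ m g → (1ℚ + m) * g ≡ g + m * g
    unfold = solve-∀ ℚ-ring

  sq : ℚ → ℚ
  sq x = x * x

  -- Each summand ±1 has variance 1 - (2p - 1)² ≤ 1. The arbitrary centre c carries the induction: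
  -- the first summand merely shifts it.
  second-moment : ∀ {n} (a : Vec Bool n) {ps} → All IsProb ps → ∀ c →
    𝔼 ps (λ v → sq (correlation a v - c)) ≤ sq (mean a ps - c) + ι n
  second-moment []       []          c = ℚₚ.≤-reflexive (sym (ℚₚ.+-identityʳ (sq (0ℚ - c))))
  second-moment {suc n} (a ∷ as) {p ∷ ps} (pr ∷ prs) c = ℚₚ.≤-trans (mix-mono pr (branch true) (branch false)) (assemble a)
    where
    shift : ∀ s x c → ((s + x - c) * (s + x - c)) ≡ ((x - (c - s)) * (x - (c - s)))
    shift = solve-∀ ℚ-ring
    branch : ∀ b → 𝔼 ps (λ v → sq (correlation (a ∷ as) (b ∷ v) - c)) ≤ sq (mean as ps - (c - sgn (same a b))) + ι n
    branch b = subst (_≤ sq (mean as ps - (c - sgn (same a b))) + ι n)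
      (𝔼-cong ps (λ v → sym (trans (cong (λ x → sq (x - c)) (correlation-∷ a b as v)) (shift (sgn (same a b)) (correlation as v) c))))
      (second-moment as prs (c - sgn (same a b)))
    variance⁺ : ∀ p m c k → ((p + p - 1ℚ + m - c) * (p + p - 1ℚ + m - c)) + (1ℚ + k) ≡
      p * (((m - (c - 1ℚ)) * (m - (c - 1ℚ))) + k) + (1ℚ - p) * (((m - (c - - 1ℚ)) * (m - (c - - 1ℚ))) + k) + ((p + p - 1ℚ) * (p + p - 1ℚ))
    variance⁺ = solve-∀ ℚ-ring
    variance⁻ : ∀ p m c k → ((1ℚ - (p + p) + m - c) * (1ℚ - (p + p) + m - c)) + (1ℚ + k) ≡
      p * (((m - (c - - 1ℚ)) * (m - (c - - 1ℚ))) + k) + (1ℚ - p) * (((m - (c - 1ℚ)) * (m - (c - 1ℚ))) + k) + ((p + p - 1ℚ) * (p + p - 1ℚ))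
    variance⁻ = solve-∀ ℚ-ring
    assemble : ∀ a → p * (sq (mean as ps - (c - sgn (same a true))) + ι n)
      + (1ℚ - p) * (sq (mean as ps - (c - sgn (same a false))) + ι n) ≤ sq (drift a p + mean as ps - c) + (1ℚ + ι n)
    assemble true  = ≤-by-diff (sq (p + p - 1ℚ)) (variance⁺ p (mean as ps) c (ι n)) (0≤sq (p + p - 1ℚ))
    assemble false = ≤-by-diff (sq (p + p - 1ℚ)) (variance⁻ p (mean as ps) c (ι n)) (0≤sq (p + p - 1ℚ))

  -- A vector that is not close has correlation below t, at least t under the mean, so its squared
  -- deviation is at least t².
  chebyshev : ∀ {n} t (a : Vec Bool n) {ps} → All IsProb ps → ι t + ι t ≤ mean a ps →
    ι t * ι t * 𝔼 ps (λ v → ⟦ not (close t a v) ⟧) ≤ ι n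
  chebyshev {n} t a {ps} prs 2t≤m = ℚₚ.≤-trans
    (subst (_≤ 𝔼 ps (λ v → sq (correlation a v - m))) (𝔼-* ps (ι t * ι t) (λ v → ⟦ not (close t a v) ⟧)) (𝔼-mono prs (λ v → markov v (close? t a v))))
    (ℚₚ.≤-trans (second-moment a prs m) (ℚₚ.≤-reflexive (centred m (ι n))))
    where
    m : ℚ
    m = mean a ps
    centred : ∀ m k → ((m - m) * (m - m)) + k ≡ k
    centred = solve-∀ ℚ-ring
    factor : ∀ m x y t → ((x - y - m) * (x - y - m)) ≡ t * t * 1ℚ + ((m - (t + t)) + (y + t - x)) * ((m - (t + t)) + (y + t - x) + t + t)
    factor = solve-∀ ℚ-ring
    markov : ∀ v (d : Dec (Close t a v)) → ι t * ι t * ⟦ not (does d) ⟧ ≤ sq (correlation a v - m)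
    markov v (yes _) = subst (_≤ sq (correlation a v - m)) (sym (ℚₚ.*-zeroʳ (ι t * ι t))) (0≤sq (correlation a v - m))
    markov v (no far) = ≤-by-diff _ (factor m (ι (agreements a v)) (ι (disagreements a v)) (ι t))
        (0≤* gap (0≤+ (0≤+ gap (0≤ι t)) (0≤ι t)))
      where
      few : ι (agreements a v) ≤ ι (disagreements a v) + ι t
      few = subst (ι (agreements a v) ≤_) (ι-+ (disagreements a v) t) (ι-mono (ℕₚ.<⇒≤ (ℕₚ.≰⇒> far)))
      gap : 0ℚ ≤ (m - (ι t + ι t)) + (ι (disagreements a v) + ι t - ι (agreements a v))
      gap = 0≤+ (diff≥0 2t≤m) (diff≥0 few)

-- From hard distributions to randomized lower bounds

module DistributionalBound where
  open OrderedField
  open Expectation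
  open Q using (_+_; _*_; _-_; -_; _≤_; _<_)

  outputs : ∀ {n} → Bool → DT n → Input n → ℚ
  outputs b t x = ⟦ does (eval t x ≟ b) ⟧

  module _ {n N : ℕ} (ps qs : Vec ℚ n) (X Y : Vec Bool n → Input N) where

    -- The two hypotheses are added without normalisation: a constant tree scores 1, a perfect one
    -- 2.
    success : DT N → ℚ
    success t = 𝔼 ps (λ v → outputs true t (X v)) + 𝔼 qs (λ v → outputs false t (Y v))

    expectedWeight : RDT N → ℚ
    expectedWeight D = 𝔼 ps (λ v → ι (weightOutputting D (X v) true)) + 𝔼 qs (λ v → ι (weightOutputting D (Y v) false))

    expectedWeight-∷ : ∀ w t D → expectedWeight ((w , t) ∷ D) ≡ ι (suc w) * success t + expectedWeight D
    expectedWeight-∷ w t D = trans (cong₂ _+_ (part ps X true) (part qs Y false))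
      (regroup (ι (suc w)) (𝔼 ps (λ v → outputs true t (X v))) (𝔼 qs (λ v → outputs false t (Y v))) _ _)
      where
      if-ι : ∀ c → ι (if c then suc w else 0) ≡ ι (suc w) * ⟦ c ⟧
      if-ι true  = sym (ℚₚ.*-identityʳ (ι (suc w)))
      if-ι false = sym (ℚₚ.*-zeroʳ (ι (suc w)))
      part : ∀ ps (X : Vec Bool n → Input N) b → 𝔼 ps (λ v → ι (weightOutputting ((w , t) ∷ D) (X v) b)) ≡
        ι (suc w) * 𝔼 ps (λ v → outputs b t (X v)) + 𝔼 ps (λ v → ι (weightOutputting D (X v) b))
      part ps X b = trans
        (𝔼-cong ps (λ v → trans (ι-+ (if does (eval t (X v) ≟ b) then suc w else 0) (weightOutputting D (X v) b))
          (cong (λ x → x + ι (weightOutputting D (X v) b)) (if-ι (does (eval t (X v) ≟ b))))))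
        (trans (𝔼-+ ps (λ v → ι (suc w) * outputs b t (X v)) (λ v → ι (weightOutputting D (X v) b)))
          (cong (λ x → x + 𝔼 ps (λ v → ι (weightOutputting D (X v) b))) (𝔼-* ps (ι (suc w)) (λ v → outputs b t (X v)))))
      regroup : ∀ k a b c d → k * a + c + (k * b + d) ≡ k * (a + b) + (c + d)
      regroup = solve-∀ ℚ-ring

    expectedWeight-upper : ∀ {q c} → (∀ t → depth t N.≤ q → success t ≤ c) →
      ∀ D → cost D N.≤ q → expectedWeight D ≤ c * ι (totalWeight D)
    expectedWeight-upper {c = c} bound [] _ = ℚₚ.≤-reflexive
      (trans (cong₂ _+_ (𝔼-const ps 0ℚ) (𝔼-const qs 0ℚ)) (sym (ℚₚ.*-zeroʳ c)))
    expectedWeight-upper {c = c} bound ((w , t) ∷ D) ≤q = subst₂ _≤_ (sym (expectedWeight-∷ w t D))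
      (trans (distrib (ι (suc w)) c (ι (totalWeight D))) (cong (c *_) (sym (ι-+ (suc w) (totalWeight D)))))
      (ℚₚ.+-mono-≤ (*-monoʳ (ι (suc w)) (0≤ι (suc w)) (bound t (ℕₚ.m⊔n≤o⇒m≤o (depth t) (cost D) ≤q)))
        (expectedWeight-upper bound D (ℕₚ.m⊔n≤o⇒n≤o (depth t) (cost D) ≤q)))
      where
      distrib : ∀ a c b → a * c + c * b ≡ c * (a + b)
      distrib = solve-∀ ℚ-ring

    -- The hard distribution may leave the domain. `B` marks draws on which the promise holds; on
    -- the others the weight is bounded below by 0, so the probability of the promise appears as a
    -- factor.
    correct-lower : ∀ {f : PartialFn N} {D} (ps : Vec ℚ n) (X : Vec Bool n → Input N) b (B : Vec Bool n → Bool) →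
      All IsProb ps → (∀ v → B v ≡ true → f (X v) ≡ just b) → Computes D f →
      ι (2 N.* totalWeight D) * 𝔼 ps (λ v → ⟦ B v ⟧) ≤ ι 3 * 𝔼 ps (λ v → ι (weightOutputting D (X v) b))
    correct-lower {f} {D} ps X b B prs inDom (_ , correct) = subst₂ _≤_
      (𝔼-* ps (ι (2 N.* totalWeight D)) (λ v → ⟦ B v ⟧)) (𝔼-* ps (ι 3) (λ v → ι (weightOutputting D (X v) b)))
      (𝔼-mono prs pointwise)
      where
      T2 : ℚ
      T2 = ι (2 N.* totalWeight D)
      pointwise : ∀ v → T2 * ⟦ B v ⟧ ≤ ι 3 * ι (weightOutputting D (X v) b)
      pointwise v with B v in eq
      ... | true  = subst₂ _≤_ (sym (ℚₚ.*-identityʳ T2)) (ι-* 3 (weightOutputting D (X v) b)) (ι-mono (correct (X v) b (inDom v eq)))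
      ... | false = subst (_≤ ι 3 * ι (weightOutputting D (X v) b)) (sym (ℚₚ.*-zeroʳ T2)) (0≤* (0≤ι 3) (0≤ι (weightOutputting D (X v) b)))

    -- The easy direction of Yao's principle.
    distributional-bound : ∀ {f : PartialFn N} {D q c} (B C : Vec Bool n → Bool) → All IsProb ps → All IsProb qs →
      (∀ v → B v ≡ true → f (X v) ≡ just true) → (∀ v → C v ≡ true → f (Y v) ≡ just false) →
      (∀ t → depth t N.≤ q → success t ≤ c) → Computes D f → cost D N.≤ q →
      2ℚ * (𝔼 ps (λ v → ⟦ B v ⟧) + 𝔼 qs (λ v → ⟦ C v ⟧)) ≤ ι 3 * c
    distributional-bound {f} {D} {q} {c} B C prs qrs fB fC bound comp ≤q = *-cancelˡ (ι T) (0<ι⁺ (proj₁ comp))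
      (ℚₚ.≤-trans (ℚₚ.≤-reflexive expand) (ℚₚ.≤-trans
        (ℚₚ.+-mono-≤ (correct-lower {f} {D} ps X true B prs fB comp) (correct-lower {f} {D} qs Y false C qrs fC comp))
        (ℚₚ.≤-trans (ℚₚ.≤-reflexive (sym (ℚₚ.*-distribˡ-+ (ι 3) (𝔼 ps (λ v → ι (weightOutputting D (X v) true))) (𝔼 qs (λ v → ι (weightOutputting D (Y v) false))))))
          (ℚₚ.≤-trans (*-monoʳ (ι 3) (0≤ι 3) (expectedWeight-upper bound D ≤q)) (ℚₚ.≤-reflexive (swap (ι 3) c (ι T)))))))
      where
      T : ℕ
      T = totalWeight D
      swap : ∀ a c b → a * (c * b) ≡ b * (a * c)
      swap = solve-∀ ℚ-ring
      regroup : ∀ t a b → t * (2ℚ * (a + b)) ≡ (ι 2 * t) * a + (ι 2 * t) * b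
      regroup = solve-∀ ℚ-ring
      expand : ι T * (2ℚ * (𝔼 ps (λ v → ⟦ B v ⟧) + 𝔼 qs (λ v → ⟦ C v ⟧))) ≡
        ι (2 N.* T) * 𝔼 ps (λ v → ⟦ B v ⟧) + ι (2 N.* T) * 𝔼 qs (λ v → ⟦ C v ⟧)
      expand = trans (regroup (ι T) (𝔼 ps (λ v → ⟦ B v ⟧)) (𝔼 qs (λ v → ⟦ C v ⟧)))
        (cong (λ x → x * 𝔼 ps (λ v → ⟦ B v ⟧) + x * 𝔼 qs (λ v → ⟦ C v ⟧)) (sym (ι-* 2 T)))

-- Product laws conditioned on answered queries

module PartialAssignments where
  open OrderedField
  open Expectation
  open Q using (_+_; _*_; _-_; -_; _≤_; _<_)

  chance : ℚ → Maybe Bool → ℚ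
  chance β nothing  = β
  chance β (just b) = ⟦ b ⟧

  -- Conditioning independent bits on some of their values gives a law of the same shape, so
  -- inductions over a decision tree can carry ρ as the record of the answers.
  law : ∀ {n} → ℚ → Vec (Maybe Bool) n → Vec ℚ n
  law β = Vec.map (chance β)

  law-prob : ∀ {n β} (ρ : Vec (Maybe Bool) n) → IsProb β → All IsProb (law β ρ)
  law-prob []                pr = []
  law-prob (nothing    ∷ ρ) pr = pr ∷ law-prob ρ pr
  law-prob (just true  ∷ ρ) pr = (0≤1 , ℚₚ.≤-refl) ∷ law-prob ρ pr
  law-prob (just false ∷ ρ) pr = (ℚₚ.≤-refl , 0≤1) ∷ law-prob ρ pr

  law-determined : ∀ {n} β (ρ : Vec (Maybe Bool) n) i b {F G} → lookup ρ i ≡ just b →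
    (∀ v → lookup v i ≡ b → F v ≡ G v) → 𝔼 (law β ρ) F ≡ 𝔼 (law β ρ) G
  law-determined β ρ i b eq = 𝔼-determined (law β ρ) i b (trans (Vecₚ.lookup-map i (chance β) ρ) (cong (chance β) eq))

  law-split : ∀ {n} β (ρ : Vec (Maybe Bool) n) i {F G H} → lookup ρ i ≡ nothing →
    (∀ v → lookup v i ≡ true → F v ≡ G v) → (∀ v → lookup v i ≡ false → F v ≡ H v) →
    𝔼 (law β ρ) F ≡ β * 𝔼 (law β (ρ [ i ]≔ just true)) G + (1ℚ - β) * 𝔼 (law β (ρ [ i ]≔ just false)) H
  law-split β ρ i {F} {G} {H} eq F≗G F≗H = trans (𝔼-split (law β ρ) i F)
    (cong₂ _+_ (cong₂ _*_ β≡ (part true F≗G)) (cong₂ (λ x y → (1ℚ - x) * y) β≡ (part false F≗H)))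
    where
    β≡ : lookup (law β ρ) i ≡ β
    β≡ = trans (Vecₚ.lookup-map i (chance β) ρ) (cong (chance β) eq)
    part : ∀ b {G} → (∀ v → lookup v i ≡ b → F v ≡ G v) →
      𝔼 (law β ρ [ i ]≔ ⟦ b ⟧) F ≡ 𝔼 (law β (ρ [ i ]≔ just b)) G
    part b {G} F≗G = trans (cong (λ ps → 𝔼 ps F) (sym (Vecₚ.map-[]≔ (chance β) ρ i)))
      (law-determined β (ρ [ i ]≔ just b) i b (Vecₚ.lookup∘updateAt i ρ) F≗G)

-- Biased against uniform bits: the chi-square method

module LikelihoodRatio where
  open OrderedField
  open Expectation
  open DistributionalBound
  open PartialAssignments
  open Q using (_+_; _*_; _-_; -_; _≤_; _<_)

  16ℚ 64ℚ : ℚ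
  16ℚ = 4ℚ * 4ℚ
  64ℚ = 16ℚ * 4ℚ

  -- (1 + δ²)^q bounds the second moment of the likelihood ratio of the biased law against the uniform
  -- one, and the leaves use 16y ≤ 64y² + 1. Here z is the likelihood ratio of the bits already fixed.
  chi-square : ∀ {n} (t : DT n) b δ q → depth t N.≤ q → ∀ (ρ : Vec (Maybe Bool) n) z →
    16ℚ * (z * 𝔼 (law (½ * (1ℚ + δ)) ρ) (λ v → outputs b t (lookup v)) - 𝔼 (law ½ ρ) (λ v → outputs b t (lookup v)))
      ≤ 64ℚ * (z * z * (1ℚ + δ * δ) ^ q - z - z + 1ℚ) + 1ℚ
  chi-square (leaf c) b δ q _ ρ z = subst (_≤ 64ℚ * (z * z * X - z - z + 1ℚ) + 1ℚ)
    (cong₂ (λ x y → 16ℚ * (z * x - y)) (sym (𝔼-const (law (½ * (1ℚ + δ)) ρ) ⟦ does (c ≟ b) ⟧))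
                                         (sym (𝔼-const (law ½ ρ) ⟦ does (c ≟ b) ⟧)))
    (bound (does (c ≟ b)))
    where
    X : ℚ
    X = (1ℚ + δ * δ) ^ q
    0≤X-1 : 0ℚ ≤ X - 1ℚ
    0≤X-1 = diff≥0 (1≤^ q (≤-by-diff (δ * δ) refl (0≤sq δ)))
    leaf-true : ∀ z X → 64ℚ * (z * z * X - z - z + 1ℚ) + 1ℚ ≡
      16ℚ * (z * 1ℚ - 1ℚ) + (64ℚ * (z * z * (X - 1ℚ)) + ((4ℚ + 4ℚ) * (z - 1ℚ) - 1ℚ) * ((4ℚ + 4ℚ) * (z - 1ℚ) - 1ℚ))
    leaf-true = solve-∀ ℚ-ring
    leaf-false : ∀ z X → 64ℚ * (z * z * X - z - z + 1ℚ) + 1ℚ ≡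
      16ℚ * (z * 0ℚ - 0ℚ) + (64ℚ * (z * z * (X - 1ℚ)) + (64ℚ * ((z - 1ℚ) * (z - 1ℚ)) + 1ℚ))
    leaf-false = solve-∀ ℚ-ring
    0≤64 : 0ℚ ≤ 64ℚ
    0≤64 = ℚₚ.nonNegative⁻¹ 64ℚ
    bound : ∀ d → 16ℚ * (z * ⟦ d ⟧ - ⟦ d ⟧) ≤ 64ℚ * (z * z * X - z - z + 1ℚ) + 1ℚ
    bound true  = ≤-by-diff _ (leaf-true z X)
      (0≤+ (0≤* 0≤64 (0≤* (0≤sq z) 0≤X-1)) (0≤sq ((4ℚ + 4ℚ) * (z - 1ℚ) - 1ℚ)))
    bound false = ≤-by-diff _ (leaf-false z X)
      (0≤+ (0≤* 0≤64 (0≤* (0≤sq z) 0≤X-1)) (0≤+ (0≤* 0≤64 (0≤sq (z - 1ℚ))) 0≤1))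
  chi-square (node i l r) b δ (suc q) (N.s≤s ≤q) ρ z with lookup ρ i in eq
  -- A repeated query reveals nothing, so the full budget and the same z pass to the branch taken.
  ... | just true  = subst (_≤ 64ℚ * (z * z * (1ℚ + δ * δ) ^ suc q - z - z + 1ℚ) + 1ℚ) (sym (cong₂ (λ x y → 16ℚ * (z * x - y)) (descend (½ * (1ℚ + δ))) (descend ½)))
      (chi-square r b δ (suc q) (ℕₚ.m≤n⇒m≤1+n (ℕₚ.m⊔n≤o⇒n≤o (depth l) (depth r) ≤q)) ρ z)
    where
    descend : ∀ β → 𝔼 (law β ρ) (λ v → outputs b (node i l r) (lookup v)) ≡ 𝔼 (law β ρ) (λ v → outputs b r (lookup v))
    descend β = law-determined β ρ i true eq (λ v vᵢ → cong (λ c → ⟦ does ((if c then eval r (lookup v) else eval l (lookup v)) ≟ b) ⟧) vᵢ)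
  ... | just false = subst (_≤ 64ℚ * (z * z * (1ℚ + δ * δ) ^ suc q - z - z + 1ℚ) + 1ℚ) (sym (cong₂ (λ x y → 16ℚ * (z * x - y)) (descend (½ * (1ℚ + δ))) (descend ½)))
      (chi-square l b δ (suc q) (ℕₚ.m≤n⇒m≤1+n (ℕₚ.m⊔n≤o⇒m≤o (depth l) (depth r) ≤q)) ρ z)
    where
    descend : ∀ β → 𝔼 (law β ρ) (λ v → outputs b (node i l r) (lookup v)) ≡ 𝔼 (law β ρ) (λ v → outputs b l (lookup v))
    descend β = law-determined β ρ i false eq (λ v vᵢ → cong (λ c → ⟦ does ((if c then eval r (lookup v) else eval l (lookup v)) ≟ b) ⟧) vᵢ)
  -- At an unread bit z becomes z(1 + δ) or z(1 - δ), each with uniform weight 1/2. The linear terms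
  -- average to z and the squares to z²(1 + δ²), which consumes one of the factors.
  ... | nothing = subst₂ _≤_
      (trans (average (𝔼 (law β ρ₁) R) (𝔼 (law ½ ρ₁) R) (𝔼 (law β ρ₀) L) (𝔼 (law ½ ρ₀) L) z δ)
        (sym (cong₂ (λ x y → 16ℚ * (z * x - y)) (descend β) (descend ½))))
      (recombine z ((1ℚ + δ * δ) ^ q) δ)
      (ℚₚ.+-mono-≤
        (*-monoʳ ½ 0≤½ (chi-square r b δ q (ℕₚ.m⊔n≤o⇒n≤o (depth l) (depth r) ≤q) ρ₁ (z * (1ℚ + δ))))
        (*-monoʳ ½ 0≤½ (chi-square l b δ q (ℕₚ.m⊔n≤o⇒m≤o (depth l) (depth r) ≤q) ρ₀ (z * (1ℚ - δ)))))
    where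
    β : ℚ
    β = ½ * (1ℚ + δ)
    ρ₁ ρ₀ : Vec (Maybe Bool) _
    ρ₁ = ρ [ i ]≔ just true
    ρ₀ = ρ [ i ]≔ just false
    R L : Vec Bool _ → ℚ
    R v = outputs b r (lookup v)
    L v = outputs b l (lookup v)
    choose : ∀ v {c} → lookup v i ≡ c → outputs b (node i l r) (lookup v) ≡ ⟦ does ((if c then eval r (lookup v) else eval l (lookup v)) ≟ b) ⟧
    choose v vᵢ = cong (λ c → ⟦ does ((if c then eval r (lookup v) else eval l (lookup v)) ≟ b) ⟧) vᵢ
    descend : ∀ β → 𝔼 (law β ρ) (λ v → outputs b (node i l r) (lookup v)) ≡ β * 𝔼 (law β ρ₁) R + (1ℚ - β) * 𝔼 (law β ρ₀) L
    descend β = law-split β ρ i eq (λ v → choose v) (λ v → choose v)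
    average : ∀ a₁ u₁ a₀ u₀ z δ →
      ½ * (16ℚ * (z * (1ℚ + δ) * a₁ - u₁)) + ½ * (16ℚ * (z * (1ℚ - δ) * a₀ - u₀)) ≡
      16ℚ * (z * (½ * (1ℚ + δ) * a₁ + (1ℚ - ½ * (1ℚ + δ)) * a₀) - (½ * u₁ + (1ℚ - ½) * u₀))
    average = solve-∀ ℚ-ring
    recombine : ∀ z X δ →
      ½ * (64ℚ * (z * (1ℚ + δ) * (z * (1ℚ + δ)) * X - z * (1ℚ + δ) - z * (1ℚ + δ) + 1ℚ) + 1ℚ) +
      ½ * (64ℚ * (z * (1ℚ - δ) * (z * (1ℚ - δ)) * X - z * (1ℚ - δ) - z * (1ℚ - δ) + 1ℚ) + 1ℚ) ≡
      64ℚ * (z * z * ((1ℚ + δ * δ) * X) - z - z + 1ℚ) + 1ℚ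
    recombine = solve-∀ ℚ-ring

-- Gap majority and approximate indexing

module PromiseFunctions where
  open Concentration

  -- The first condition takes precedence; the exclusiveness of the two promises enters through
  -- `fromDec-false⁺`.
  fromDec : ∀ {P Q : Set} → Dec P → Dec Q → Maybe Bool
  fromDec (yes _) _       = just true
  fromDec (no _)  (yes _) = just false
  fromDec (no _)  (no _)  = nothing

  module _ {P Q : Set} where
    fromDec-true⁺ : (p? : Dec P) (q? : Dec Q) → P → fromDec p? q? ≡ just true
    fromDec-true⁺ (yes _) _ _ = refl
    fromDec-true⁺ (no ¬p) _ p = contradiction p ¬p

    fromDec-false⁺ : (p? : Dec P) (q? : Dec Q) → ¬ P → Q → fromDec p? q? ≡ just false
    fromDec-false⁺ (yes p) _       ¬p q = contradiction p ¬p
    fromDec-false⁺ (no _)  (yes _) _  _ = refl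
    fromDec-false⁺ (no _)  (no ¬q) _  q = contradiction q ¬q

    fromDec-true⁻ : (p? : Dec P) (q? : Dec Q) → fromDec p? q? ≡ just true → P
    fromDec-true⁻ (yes p) _       _ = p
    fromDec-true⁻ (no _)  (yes _) ()
    fromDec-true⁻ (no _)  (no _)  ()

    fromDec-false⁻ : (p? : Dec P) (q? : Dec Q) → fromDec p? q? ≡ just false → Q
    fromDec-false⁻ (no _) (yes q) _ = q
    fromDec-false⁻ (no _) (no _) ()

  fromDec-cong : ∀ {P P′ Q Q′ : Set} {p? : Dec P} {p′? : Dec P′} {q? : Dec Q} {q′? : Dec Q′} →
    (P → P′) → (P′ → P) → (Q → Q′) → (Q′ → Q) → fromDec p? q? ≡ fromDec p′? q′?
  fromDec-cong {p? = yes p} {p′?} {q? = _} {q′?} P→P′ _ _ _ = sym (fromDec-true⁺ p′? q′? (P→P′ p))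
  fromDec-cong {p? = no ¬p} {yes p′} _ P′→P _ _ = contradiction (P′→P p′) ¬p
  fromDec-cong {p? = no ¬p} {no _} {yes _} {yes _}  _ _ _ _ = refl
  fromDec-cong {p? = no ¬p} {no _} {yes q} {no ¬q′} _ _ Q→Q′ _ = contradiction (Q→Q′ q) ¬q′
  fromDec-cong {p? = no ¬p} {no _} {no ¬q} {yes q′} _ _ _ Q′→Q = contradiction (Q′→Q q′) ¬q
  fromDec-cong {p? = no ¬p} {no _} {no _}  {no _}   _ _ _ _ = refl

  gapMajorityᵛ : ∀ {m} → ℕ → Vec Bool m → Maybe Bool
  gapMajorityᵛ {m} t v = fromDec (close? t (replicate m true) v) (close? t (replicate m false) v)

  gapMajority : ∀ m → ℕ → PartialFn m
  gapMajority m t x = gapMajorityᵛ t (tabulate x)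

  gapMajority-ext : ∀ m t → Extensional (gapMajority m t)
  gapMajority-ext m t x≗y = cong (gapMajorityᵛ t) (Vecₚ.tabulate-cong x≗y)

  bit : Bool → Fin 2
  bit true  = zero
  bit false = suc zero

  unbit : Fin 2 → Bool
  unbit zero    = true
  unbit (suc _) = false

  encode : ∀ {n} → Vec Bool n → Fin (2 N.^ n)
  encode []      = zero
  encode (b ∷ v) = Fin.combine (bit b) (encode v)

  decode : ∀ n → Fin (2 N.^ n) → Vec Bool n
  decode zero    _ = []
  decode (suc n) c = unbit (proj₁ (remQuot {2} (2 N.^ n) c)) ∷ decode n (proj₂ (remQuot {2} (2 N.^ n) c))

  decode-encode : ∀ {n} (v : Vec Bool n) → decode n (encode v) ≡ v
  decode-encode [] = refl
  decode-encode {suc n} (b ∷ v) = trans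
    (cong (λ p → unbit (proj₁ p) ∷ decode n (proj₂ p)) (Finₚ.remQuot-combine {2} (bit b) (encode v)))
    (cong₂ _∷_ (unbit-bit b) (decode-encode v))
    where
    unbit-bit : ∀ b → unbit (bit b) ≡ b
    unbit-bit true  = refl
    unbit-bit false = refl

  module _ (K t : ℕ) where

    address : Input (K N.+ 2 N.^ K) → Vec Bool K
    address x = tabulate (λ i → x (i ↑ˡ (2 N.^ K)))

    cell : Input (K N.+ 2 N.^ K) → Fin (2 N.^ K) → Bool
    cell x c = x (K ↑ʳ c)

    MarksNeighbours MarksNothing : Input (K N.+ 2 N.^ K) → Set
    MarksNeighbours x = ∀ c → cell x c ≡ close t (address x) (decode K c)
    MarksNothing    x = ∀ c → cell x c ≡ false

    marksNeighbours? : ∀ x → Dec (MarksNeighbours x)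
    marksNeighbours? x = Finₚ.all? (λ c → cell x c ≟ close t (address x) (decode K c))

    marksNothing? : ∀ x → Dec (MarksNothing x)
    marksNothing? x = Finₚ.all? (λ c → cell x c ≟ false)

    approxIndex : PartialFn (K N.+ 2 N.^ K)
    approxIndex x = fromDec (marksNeighbours? x) (marksNothing? x)

    approxIndex-ext : Extensional approxIndex
    approxIndex-ext x≗y = fromDec-cong (transport x≗y) (transport (λ i → sym (x≗y i)))
      (λ zeros c → trans (sym (x≗y (K ↑ʳ c))) (zeros c)) (λ zeros c → trans (x≗y (K ↑ʳ c)) (zeros c))
      where
      transport : ∀ {x y} → x ≗ y → MarksNeighbours x → MarksNeighbours y
      transport x≗y marks c = trans (sym (x≗y (K ↑ʳ c))) (trans (marks c)
        (cong (λ a → close t a (decode K c)) (Vecₚ.tabulate-cong (λ i → x≗y (i ↑ˡ (2 N.^ K))))))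

-- Lower bound for gap majority

module GapMajorityLowerBound where
  open OrderedField
  open Expectation
  open Concentration
  open DistributionalBound
  open PartialAssignments
  open LikelihoodRatio
  open PromiseFunctions
  open Q using (_+_; _*_; _-_; -_; _≤_; _<_)

  replicate-far : ∀ {m} b (v : Vec Bool m) → agreements (replicate m (not b)) v ≡ disagreements (replicate m b) v
    × disagreements (replicate m (not b)) v ≡ agreements (replicate m b) v
  replicate-far b []      = refl , refl
  replicate-far b (c ∷ v) with b | c | replicate-far b v
  ... | true  | true  | p , q = p , cong suc q
  ... | true  | false | p , q = cong suc p , q
  ... | false | true  | p , q = cong suc p , q
  ... | false | false | p , q = p , cong suc q

  not-both-close : ∀ {m t} (v : Vec Bool m) → 0 N.< t → Close t (replicate m false) v → ¬ Close t (replicate m true) v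
  not-both-close {m} {t} v 0<t cf ct with replicate-far true v
  ... | p , q = ℕₚ.<⇒≱ (ℕₚ.<-≤-trans (ℕₚ.m<m+n (agreements (replicate m true) v) 0<t)
      (subst₂ (λ x y → x N.+ t N.≤ y) q p cf)) (ℕₚ.≤-trans (ℕₚ.m≤m+n _ t) ct)

  from-does : ∀ {P : Set} (d : Dec P) → does d ≡ true → P
  from-does (yes p) _ = p

  gapMajority-true : ∀ m t v → close t (replicate m true) v ≡ true → gapMajority m t (lookup v) ≡ just true
  gapMajority-true m t v cl rewrite Vecₚ.tabulate∘lookup v =
    fromDec-true⁺ (close? t (replicate m true) v) _ (from-does (close? t (replicate m true) v) cl)

  gapMajority-false : ∀ m t v → 0 N.< t → close t (replicate m false) v ≡ true → gapMajority m t (lookup v) ≡ just false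
  gapMajority-false m t v 0<t cl rewrite Vecₚ.tabulate∘lookup v =
    fromDec-false⁺ (close? t (replicate m true) v) (close? t (replicate m false) v) (not-both-close v 0<t far) far
    where
    far : Close t (replicate m false) v
    far = from-does (close? t (replicate m false) v) cl

  free : ∀ n → Vec (Maybe Bool) n
  free n = replicate n nothing

  -- A rational form of (1 + d)^q ≤ 1/(1 - qd): Bernoulli gives 1 - qd ≤ (1 - d)^q, and (1 + d)(1 -
  -- d) ≤ 1.
  growth-bound : ∀ q {d} → 0ℚ ≤ d → d ≤ 1ℚ → (1ℚ + d) ^ q * (1ℚ - ι q * d) ≤ 1ℚ
  growth-bound q {d} 0≤d d≤1 = ℚₚ.≤-trans
    (*-monoʳ ((1ℚ + d) ^ q) (0≤^ q (0≤+ 0≤1 0≤d))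
      (subst (_≤ (1ℚ - d) ^ q) (cong (1ℚ +_) (sym (ℚₚ.neg-distribʳ-* (ι q) d))) (bernoulli q (diff≥0 d≤1))))
    (subst (_≤ 1ℚ) (^-*-base (1ℚ + d) (1ℚ - d) q)
      (^-≤1 q (0≤* (0≤+ 0≤1 0≤d) (diff≥0 d≤1)) (≤-by-diff (d * d) (square d) (0≤sq d))))
    where
    square : ∀ d → 1ℚ ≡ (1ℚ + d) * (1ℚ - d) + d * d
    square = solve-∀ ℚ-ring

  module _ (r : ℕ) (2≤r : 2 N.≤ r) where

    M t : ℕ
    M = 16 N.* (r N.* r)
    t = 16 N.* r

    private
      0<r : 0 N.< r
      0<r = ℕₚ.≤-trans (N.s≤s N.z≤n) 2≤r

      -- The bias δ = 2/r is twice the gap t/M = 1/r. Under either biased law the mean correlation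
      -- is therefore 2t, and by Chebyshev the promise fails with probability at most M/t² = 1/16.
      γ δ : ℚ
      γ = proj₁ (inverse (0<ι⁺ 0<r))
      δ = γ + γ

      rγ≡1 : ι r * γ ≡ 1ℚ
      rγ≡1 = proj₁ (proj₂ (inverse (0<ι⁺ 0<r)))

      0≤γ : 0ℚ ≤ γ
      0≤γ = proj₂ (proj₂ (inverse (0<ι⁺ 0<r)))

      0≤δ : 0ℚ ≤ δ
      0≤δ = 0≤+ 0≤γ 0≤γ

      δ≤1 : δ ≤ 1ℚ
      δ≤1 = subst₂ _≤_ (double γ) rγ≡1 (*-monoˡ γ 0≤γ (ι-mono 2≤r))
        where
        double : ∀ g → ι 2 * g ≡ g + g
        double = solve-∀ ℚ-ring

      β : Bool → ℚ
      β true  = ½ * (1ℚ + δ)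
      β false = ½ * (1ℚ + - δ)

      β-prob : ∀ b → IsProb (β b)
      β-prob true  = 0≤* 0≤½ (0≤+ 0≤1 0≤δ) , ≤-by-diff (½ * (1ℚ - δ)) (halves δ) (0≤* 0≤½ (diff≥0 δ≤1))
        where
        halves : ∀ d → 1ℚ ≡ ½ * (1ℚ + d) + ½ * (1ℚ - d)
        halves = solve-∀ ℚ-ring
      β-prob false = 0≤* 0≤½ (diff≥0 δ≤1) , ≤-by-diff (½ * (1ℚ + δ)) (halves δ) (0≤* 0≤½ (0≤+ 0≤1 0≤δ))
        where
        halves : ∀ d → 1ℚ ≡ ½ * (1ℚ + - d) + ½ * (1ℚ + d)
        halves = solve-∀ ℚ-ring

      drift-β : ∀ b → drift b (β b) ≡ δ
      drift-β true  = twice δ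
        where
        twice : ∀ d → ½ * (1ℚ + d) + ½ * (1ℚ + d) - 1ℚ ≡ d
        twice = solve-∀ ℚ-ring
      drift-β false = twice δ
        where
        twice : ∀ d → 1ℚ - (½ * (1ℚ + - d) + ½ * (1ℚ + - d)) ≡ d
        twice = solve-∀ ℚ-ring

      biased : Bool → Vec ℚ M
      biased b = law (β b) (free M)

      mean-biased : ∀ b → ι t + ι t ≤ mean (replicate M b) (biased b)
      mean-biased b = subst (_≤ mean (replicate M b) (biased b)) threshold
        (mean-lower {γ = δ} (replicate M b) (biased b) (λ i → ℚₚ.≤-reflexive (sym
          (trans (cong₂ drift (Vecₚ.lookup-replicate i b)
            (trans (Vecₚ.lookup-map i (chance (β b)) (free M)) (cong (chance (β b)) (Vecₚ.lookup-replicate i nothing)))) (drift-β b)))))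
        where
        open ≡-Reasoning
        expand : ∀ k r g → k * (r * r) * (g + g) ≡ (k * r + k * r) * (r * g)
        expand = solve-∀ ℚ-ring
        threshold : ι M * δ ≡ ι t + ι t
        threshold = begin
          ι M * δ                               ≡⟨ cong (_* δ) (trans (ι-* 16 (r N.* r)) (cong (ι 16 *_) (ι-* r r))) ⟩
          ι 16 * (ι r * ι r) * (γ + γ)          ≡⟨ expand (ι 16) (ι r) γ ⟩
          (ι 16 * ι r + ι 16 * ι r) * (ι r * γ) ≡⟨ cong₂ _*_ (cong (λ x → x + x) (sym (ι-* 16 r))) rγ≡1 ⟩
          (ι t + ι t) * 1ℚ                      ≡⟨ ℚₚ.*-identityʳ _ ⟩
          ι t + ι t                             ∎

      promise : Bool → ℚ
      promise b = 𝔼 (biased b) (λ v → ⟦ close t (replicate M b) v ⟧)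

      promise-likely : ∀ b → ι 15 ≤ ι 16 * promise b
      promise-likely b = ≤-by-diff _ (trans (cong (λ p → ι 16 * p) good) (rewrite-bad bad))
        (diff≥0 bad-small)
        where
        bad : ℚ
        bad = 𝔼 (biased b) (λ v → ⟦ not (close t (replicate M b) v) ⟧)
        cancel : ∀ x y → x ≡ (x + y) - y
        cancel = solve-∀ ℚ-ring
        good : promise b ≡ 1ℚ - bad
        good = trans (cancel (promise b) bad) (cong (_- bad) (𝔼-complement (biased b) (λ v → close t (replicate M b) v)))
        rewrite-bad : ∀ x → ι 16 * (1ℚ - x) ≡ ι 15 + (1ℚ - ι 16 * x)
        rewrite-bad = solve-∀ ℚ-ring
        cheb : ι t * ι t * bad ≤ ι M
        cheb = chebyshev t (replicate M b) (law-prob (free M) (β-prob b)) (mean-biased b)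
        left : ∀ k r g x → g * g * (k * r * (k * r) * x) ≡ k * (k * x) * (r * g * (r * g))
        left = solve-∀ ℚ-ring
        right : ∀ k r g → g * g * (k * (r * r)) ≡ k * 1ℚ * (r * g * (r * g))
        right = solve-∀ ℚ-ring
        unit : ∀ x → x * (ι r * γ * (ι r * γ)) ≡ x
        unit x = trans (cong (λ y → x * (y * y)) rγ≡1) (ℚₚ.*-identityʳ x)
        bad-small : ι 16 * bad ≤ 1ℚ
        bad-small = *-cancelˡ (ι 16) (0<ι 15) (subst₂ _≤_
          (trans (cong (λ x → γ * γ * (x * x * bad)) (ι-* 16 r)) (trans (left (ι 16) (ι r) γ bad) (unit (ι 16 * (ι 16 * bad)))))
          (trans (cong (λ x → γ * γ * x) (trans (ι-* 16 (r N.* r)) (cong (ι 16 *_) (ι-* r r)))) (trans (right (ι 16) (ι r) γ) (unit (ι 16 * 1ℚ))))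
          (*-monoʳ (γ * γ) (0≤sq γ) cheb))

      -- Both biased laws are compared with the same uniform law, under which the chances of
      -- answering `true` and `false` add up to 1. Adding `chi-square` at z = 1 for δ and for -δ
      -- leaves 16·success ≤ 18 + 128·(X - 1) with X = (1 + δ²)^q.
      success-bound : ∀ q u → depth u N.≤ q →
        success (biased true) (biased false) lookup lookup u ≤ (½ * ½ * (½ * ½)) * (ι 18 + 64ℚ * 2ℚ * ((1ℚ + δ * δ) ^ q - 1ℚ))
      success-bound q u ≤q = *-cancelˡ 16ℚ (ℚₚ.positive⁻¹ 16ℚ) (subst₂ _≤_
        (trans (collect (𝔼 (biased true) (λ v → outputs true u (lookup v))) (𝔼 (law ½ (free M)) (λ v → outputs true u (lookup v)))
                 (𝔼 (biased false) (λ v → outputs false u (lookup v))) (𝔼 (law ½ (free M)) (λ v → outputs false u (lookup v))))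
          (trans (cong (λ x → 16ℚ * (success (biased true) (biased false) lookup lookup u) + 16ℚ * (1ℚ - x)) uniform-total)
            (vanish (success (biased true) (biased false) lookup lookup u))))
        (scale X)
        (ℚₚ.+-monoˡ-≤ 16ℚ (ℚₚ.+-mono-≤ (chi-square u true δ q ≤q (free M) 1ℚ)
          (subst (λ x → 16ℚ * (1ℚ * 𝔼 (biased false) (λ v → outputs false u (lookup v)) - 𝔼 (law ½ (free M)) (λ v → outputs false u (lookup v)))
             ≤ 64ℚ * (1ℚ * 1ℚ * (1ℚ + x) ^ q - 1ℚ - 1ℚ + 1ℚ) + 1ℚ) (neg-sq δ) (chi-square u false (- δ) q ≤q (free M) 1ℚ)))))
        where
        X : ℚ
        X = (1ℚ + δ * δ) ^ q
        neg-sq : ∀ d → - d * - d ≡ d * d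
        neg-sq = solve-∀ ℚ-ring
        collect : ∀ a u b w → 16ℚ * (1ℚ * a - u) + 16ℚ * (1ℚ * b - w) + 16ℚ ≡ 16ℚ * (a + b) + 16ℚ * (1ℚ - (u + w))
        collect = solve-∀ ℚ-ring
        vanish : ∀ x → 16ℚ * x + 16ℚ * (1ℚ - 1ℚ) ≡ 16ℚ * x
        vanish = solve-∀ ℚ-ring
        scale : ∀ X → 64ℚ * (1ℚ * 1ℚ * X - 1ℚ - 1ℚ + 1ℚ) + 1ℚ + (64ℚ * (1ℚ * 1ℚ * X - 1ℚ - 1ℚ + 1ℚ) + 1ℚ) + 16ℚ ≡
          16ℚ * ((½ * ½ * (½ * ½)) * (ι 18 + 64ℚ * 2ℚ * (X - 1ℚ)))
        scale = solve-∀ ℚ-ring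
        uniform-total : 𝔼 (law ½ (free M)) (λ v → outputs true u (lookup v)) + 𝔼 (law ½ (free M)) (λ v → outputs false u (lookup v)) ≡ 1ℚ
        uniform-total = trans (sym (𝔼-+ (law ½ (free M)) _ _)) (trans (𝔼-cong (law ½ (free M)) (λ v → both (eval u (lookup v)))) (𝔼-const (law ½ (free M)) 1ℚ))
          where
          both : ∀ c → ⟦ does (c ≟ true) ⟧ + ⟦ does (c ≟ false) ⟧ ≡ 1ℚ
          both true  = refl
          both false = refl

      128ℚ 127ℚ 384ℚ : ℚ
      128ℚ = 64ℚ * 2ℚ
      127ℚ = 128ℚ - 1ℚ
      384ℚ = 128ℚ + 128ℚ + 128ℚ

      few-queries-absurd : ∀ D → Computes D (gapMajority M t) → ¬ 8 N.* (8 N.* (8 N.* cost D)) N.≤ r N.* r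
      -- If 512·q ≤ r² then qδ² ≤ 1/128, so X ≤ 128/127 and three times the success is at most 3·(18
      -- + 128/127)/16 < 3.6. The promise demands 2·(15/16 + 15/16) = 3.75. The multipliers cancel X
      -- and both promise probabilities, leaving the constant -378.
      few-queries-absurd D comp small = from-no (0ℚ ℚₚ.≤? 384ℚ * 128ℚ - 127ℚ * (64ℚ * (4ℚ + 2ℚ) + (4ℚ + 2ℚ)))
        (subst (0ℚ ≤_) (combination (promise true) (promise false) X)
          (0≤+ (0≤+ (0≤+ (0≤* (ℚₚ.nonNegative⁻¹ (127ℚ * 16ℚ)) (diff≥0 separation))
            (0≤* (ℚₚ.nonNegative⁻¹ (127ℚ * 2ℚ)) (diff≥0 (promise-likely true))))
            (0≤* (ℚₚ.nonNegative⁻¹ (127ℚ * 2ℚ)) (diff≥0 (promise-likely false))))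
            (0≤* (ℚₚ.nonNegative⁻¹ 384ℚ) X-small)))
        where
        q : ℕ
        q = cost D
        X e : ℚ
        X = (1ℚ + δ * δ) ^ q
        e = ι q * (δ * δ)
        δδ≤1 : δ * δ ≤ 1ℚ
        δδ≤1 = *-mono 0≤δ 0≤1 δ≤1 δ≤1
        separation : 2ℚ * (promise true + promise false) ≤ ι 3 * ((½ * ½ * (½ * ½)) * (ι 18 + 64ℚ * 2ℚ * (X - 1ℚ)))
        separation = distributional-bound (biased true) (biased false) lookup lookup {gapMajority M t} {D}
          (close t (replicate M true)) (close t (replicate M false))
          (law-prob (free M) (β-prob true)) (law-prob (free M) (β-prob false))
          (gapMajority-true M t) (λ v → gapMajority-false M t v (ℕₚ.≤-trans 0<r (ℕₚ.m≤m+n r _)))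
          (success-bound q) comp ℕₚ.≤-refl
        rescale : ∀ q g → g * g * (ι 8 * (ι 8 * (ι 8 * q))) ≡ 128ℚ * (q * ((g + g) * (g + g)))
        rescale = solve-∀ ℚ-ring
        unit : ∀ r g → g * g * (r * r) ≡ r * g * (r * g)
        unit = solve-∀ ℚ-ring
        ι-512 : ι (8 N.* (8 N.* (8 N.* q))) ≡ ι 8 * (ι 8 * (ι 8 * ι q))
        ι-512 = trans (ι-* 8 (8 N.* (8 N.* q))) (cong (ι 8 *_) (trans (ι-* 8 (8 N.* q)) (cong (ι 8 *_) (ι-* 8 q))))
        e-small : 128ℚ * e ≤ 1ℚ
        e-small = subst₂ _≤_ (trans (cong (γ * γ *_) ι-512) (rescale (ι q) γ))
          (trans (cong (γ * γ *_) (ι-* r r)) (trans (unit (ι r) γ) (cong (λ x → x * x) rγ≡1)))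
          (*-monoʳ (γ * γ) (0≤sq γ) (ι-mono small))
        split : ∀ X e → 128ℚ * (1ℚ - X * (1ℚ - e)) + X * (1ℚ - 128ℚ * e) ≡ 128ℚ - 127ℚ * X
        split = solve-∀ ℚ-ring
        X-small : 0ℚ ≤ 128ℚ - 127ℚ * X
        X-small = subst (0ℚ ≤_) (split X e) (0≤+
          (0≤* (ℚₚ.nonNegative⁻¹ 128ℚ) (diff≥0 (growth-bound q (0≤sq δ) δδ≤1)))
          (0≤* (0≤^ q (0≤+ 0≤1 (0≤sq δ))) (diff≥0 e-small)))
        combination : ∀ a b X →
          127ℚ * 16ℚ * (ι 3 * ((½ * ½ * (½ * ½)) * (ι 18 + 64ℚ * 2ℚ * (X - 1ℚ))) - 2ℚ * (a + b))
            + 127ℚ * 2ℚ * (ι 16 * a - ι 15) + 127ℚ * 2ℚ * (ι 16 * b - ι 15) + 384ℚ * (128ℚ - 127ℚ * X)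
          ≡ 384ℚ * 128ℚ - 127ℚ * (64ℚ * (4ℚ + 2ℚ) + (4ℚ + 2ℚ))
        combination = solve-∀ ℚ-ring

    gapMajority-lower : ∀ {m u} → m ≡ M → u ≡ t → ∀ D → Computes D (gapMajority m u) → r N.* r N.≤ 512 N.* cost D
    gapMajority-lower refl refl D comp with r N.* r ℕₚ.≤? 512 N.* cost D
    ... | yes ≤q = ≤q
    ... | no  ≰q = contradiction (subst (N._≤ r N.* r) (collect (cost D)) (ℕₚ.<⇒≤ (ℕₚ.≰⇒> ≰q))) (few-queries-absurd D comp)
      where
      collect : ∀ x → 512 N.* x ≡ 8 N.* (8 N.* (8 N.* x))
      collect = ℕ-Solver.solve-∀

-- Lower bound for approximate indexing

module ApproxIndexLowerBound where
  open OrderedField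
  open Expectation
  open Concentration
  open DistributionalBound
  open PartialAssignments
  open PromiseFunctions
  open Q using (_+_; _*_; _-_; -_; _≤_; _<_)

  ½-prob : IsProb ½
  ½-prob = 0≤½ , from-yes (½ ℚₚ.≤? 1ℚ)

  module _ (σ : ℚ) (0≤σ : 0ℚ ≤ σ) (σ≤1 : σ ≤ 1ℚ) where

    private
      u w : ℚ
      u = 1ℚ + σ
      w = 1ℚ - σ

      0≤u : 0ℚ ≤ u
      0≤u = 0≤+ 0≤1 0≤σ

      1≤u : 1ℚ ≤ u
      1≤u = ≤-by-diff σ refl 0≤σ

      0≤w : 0ℚ ≤ w
      0≤w = diff≥0 σ≤1

    -- The exponential martingale of the number of agreements minus disagreements.
    martingale : ∀ {n} → Vec Bool n → Vec Bool n → ℚ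
    martingale a b = u ^ agreements a b * w ^ disagreements a b

    factor : Bool → ℚ
    factor true  = u
    factor false = w

    martingale-∷ : ∀ {n} a b (as bs : Vec Bool n) → martingale (a ∷ as) (b ∷ bs) ≡ factor (same a b) * martingale as bs
    martingale-∷ a b as bs with same a b
    ... | true  = ℚₚ.*-assoc u (u ^ agreements as bs) (w ^ disagreements as bs)
    ... | false = swap (u ^ agreements as bs) w (w ^ disagreements as bs)
      where
      swap : ∀ x y z → x * (y * z) ≡ y * (x * z)
      swap = solve-∀ ℚ-ring

    0≤martingale : ∀ {n} (a b : Vec Bool n) → 0ℚ ≤ martingale a b
    0≤martingale a b = 0≤* (0≤^ (agreements a b) 0≤u) (0≤^ (disagreements a b) 0≤w)

    revealed : ∀ {n} → Vec (Maybe Bool) n → ℚ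
    revealed []             = 1ℚ
    revealed (nothing ∷ ρ) = revealed ρ
    revealed (just _  ∷ ρ) = u * revealed ρ

    0≤revealed : ∀ {n} (ρ : Vec (Maybe Bool) n) → 0ℚ ≤ revealed ρ
    0≤revealed []             = 0≤1
    0≤revealed (nothing ∷ ρ) = 0≤revealed ρ
    0≤revealed (just _  ∷ ρ) = 0≤* 0≤u (0≤revealed ρ)

    revealed-update : ∀ {n} (ρ : Vec (Maybe Bool) n) i b → lookup ρ i ≡ nothing → revealed (ρ [ i ]≔ just b) ≡ u * revealed ρ
    revealed-update (nothing ∷ ρ) zero    b _  = refl
    revealed-update (nothing ∷ ρ) (suc i) b eq = revealed-update ρ i b eq
    revealed-update (just _  ∷ ρ) (suc i) b eq = cong (u *_) (revealed-update ρ i b eq)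

    factor≤u : ∀ c → factor c ≤ u
    factor≤u true  = ℚₚ.≤-refl
    factor≤u false = ≤-by-diff (σ + σ) (shift σ) (0≤+ 0≤σ 0≤σ)
      where
      shift : ∀ s → 1ℚ + s ≡ 1ℚ - s + (s + s)
      shift = solve-∀ ℚ-ring

    -- A free bit contributes the factor (u + w)/2 = 1 on average, a known one at most u.
    martingale-mean : ∀ {n} (ρ : Vec (Maybe Bool) n) b → 𝔼 (law ½ ρ) (λ a → martingale a b) ≤ revealed ρ
    martingale-mean []       []       = ℚₚ.≤-refl
    martingale-mean (m ∷ ρ) (b ∷ bs) = ℚₚ.≤-trans (ℚₚ.≤-reflexive (cong₂ (λ x y → chance ½ m * x + (1ℚ - chance ½ m) * y) (branch true) (branch false)))
      (step m b)
      where
      E : ℚ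
      E = 𝔼 (law ½ ρ) (λ a → martingale a bs)
      branch : ∀ a → 𝔼 (law ½ ρ) (λ as → martingale (a ∷ as) (b ∷ bs)) ≡ factor (same a b) * E
      branch a = trans (𝔼-cong (law ½ ρ) (λ as → martingale-∷ a b as bs)) (𝔼-* (law ½ ρ) (factor (same a b)) (λ as → martingale as bs))
      only-true : ∀ x y → 1ℚ * x + (1ℚ - 1ℚ) * y ≡ x
      only-true = solve-∀ ℚ-ring
      only-false : ∀ x y → 0ℚ * x + (1ℚ - 0ℚ) * y ≡ y
      only-false = solve-∀ ℚ-ring
      average⁺ : ∀ s x → ½ * ((1ℚ + s) * x) + (1ℚ - ½) * ((1ℚ - s) * x) ≡ x
      average⁺ = solve-∀ ℚ-ring
      average⁻ : ∀ s x → ½ * ((1ℚ - s) * x) + (1ℚ - ½) * ((1ℚ + s) * x) ≡ x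
      average⁻ = solve-∀ ℚ-ring
      fixed : ∀ c → factor c * E ≤ u * revealed ρ
      fixed c = *-mono (0≤factor c) (0≤revealed ρ) (factor≤u c) (martingale-mean ρ bs)
        where
        0≤factor : ∀ c → 0ℚ ≤ factor c
        0≤factor true  = 0≤u
        0≤factor false = 0≤w
      step : ∀ m b → chance ½ m * (factor (same true b) * E) + (1ℚ - chance ½ m) * (factor (same false b) * E) ≤ revealed (m ∷ ρ)
      step nothing      true  = ℚₚ.≤-trans (ℚₚ.≤-reflexive (average⁺ σ E)) (martingale-mean ρ bs)
      step nothing      false = ℚₚ.≤-trans (ℚₚ.≤-reflexive (average⁻ σ E)) (martingale-mean ρ bs)
      step (just true)  b     = ℚₚ.≤-trans (ℚₚ.≤-reflexive (only-true (factor (same true b) * E) (factor (same false b) * E))) (fixed (same true b))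
      step (just false) b     = ℚₚ.≤-trans (ℚₚ.≤-reflexive (only-false (factor (same true b) * E) (factor (same false b) * E))) (fixed (same false b))

    disagreements≤n : ∀ {n} (a b : Vec Bool n) → disagreements a b N.≤ n
    disagreements≤n []       []       = N.z≤n
    disagreements≤n (a ∷ as) (b ∷ bs) with same a b
    ... | true  = ℕₚ.m≤n⇒m≤1+n (disagreements≤n as bs)
    ... | false = N.s≤s (disagreements≤n as bs)

    -- Pair each disagreement with an agreement: every pair gives u·w = 1 - σ² ≤ 1, there are at
    -- most n pairs, and at least t agreements are left over, each giving u ≥ 1.
    martingale-close : ∀ {n} t (a b : Vec Bool n) → Close t a b → (u * w) ^ n * u ^ t ≤ martingale a b
    martingale-close {n} t a b cl = subst ((u * w) ^ n * u ^ t ≤_) (sym regroup)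
      (*-mono (0≤^ n 0≤uw) (0≤* (0≤^ t 0≤u) (0≤^ extra 0≤u)) (^-antitone 0≤uw uw≤1 (disagreements≤n a b))
        (≤-by-diff (u ^ t * (u ^ extra - 1ℚ)) (unfold (u ^ t) (u ^ extra)) (0≤* (0≤^ t 0≤u) (diff≥0 (1≤^ extra 1≤u)))))
      where
      extra : ℕ
      extra = agreements a b N.∸ (disagreements a b N.+ t)
      0≤uw : 0ℚ ≤ u * w
      0≤uw = 0≤* 0≤u 0≤w
      uw≤1 : u * w ≤ 1ℚ
      uw≤1 = ≤-by-diff (σ * σ) (square σ) (0≤sq σ)
        where
        square : ∀ s → 1ℚ ≡ (1ℚ + s) * (1ℚ - s) + s * s
        square = solve-∀ ℚ-ring
      unfold : ∀ x y → x * y ≡ x + x * (y - 1ℚ)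
      unfold = solve-∀ ℚ-ring
      reorder : ∀ d w t e → d * t * e * w ≡ d * w * (t * e)
      reorder = solve-∀ ℚ-ring
      regroup : martingale a b ≡ (u * w) ^ disagreements a b * (u ^ t * u ^ extra)
      regroup = trans (cong (λ k → u ^ k * w ^ disagreements a b) (sym (ℕₚ.m+[n∸m]≡n cl)))
        (trans (cong (_* w ^ disagreements a b) (trans (^-+ u (disagreements a b N.+ t) extra) (cong (_* u ^ extra) (^-+ u (disagreements a b) t))))
          (trans (reorder (u ^ disagreements a b) (w ^ disagreements a b) (u ^ t) (u ^ extra))
            (cong (_* (u ^ t * u ^ extra)) (sym (^-*-base u w (disagreements a b))))))

    module Hybrid (K t : ℕ) (τ : ℚ) (0<τ : 0ℚ < τ) (τ≤ : τ ≤ (u * w) ^ K * u ^ t) where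

      0≤τ : 0ℚ ≤ τ
      0≤τ = ℚₚ.<⇒≤ 0<τ

      -- Markov's inequality for the martingale, which is at least τ on close pairs.
      tail : ∀ (ρ : Vec (Maybe Bool) K) b → τ * 𝔼 (law ½ ρ) (λ a → ⟦ close t a b ⟧) ≤ revealed ρ
      tail ρ b = ℚₚ.≤-trans (subst (_≤ 𝔼 (law ½ ρ) (λ a → martingale a b)) (𝔼-* (law ½ ρ) τ (λ a → ⟦ close t a b ⟧))
        (𝔼-mono (law-prob ρ ½-prob) (λ a → markov a (close? t a b)))) (martingale-mean ρ b)
        where
        markov : ∀ a (d : Dec (Close t a b)) → τ * ⟦ does d ⟧ ≤ martingale a b
        markov a (yes cl) = subst (_≤ martingale a b) (sym (ℚₚ.*-identityʳ τ)) (ℚₚ.≤-trans τ≤ (martingale-close t a b cl))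
        markov a (no _)   = subst (_≤ martingale a b) (sym (ℚₚ.*-zeroʳ τ)) (0≤martingale a b)

      readBit : Bool → Vec Bool K → Fin K ⊎ Fin (2 N.^ K) → Bool
      readBit _     a (inj₁ i) = lookup a i
      readBit true  a (inj₂ c) = close t a (decode K c)
      readBit false a (inj₂ c) = false

      instanceOf : Bool → Vec Bool K → Input (K N.+ 2 N.^ K)
      instanceOf z a j = readBit z a (splitAt K j)

      differs : DT (K N.+ 2 N.^ K) → Vec Bool K → ℚ
      differs T a = ⟦ eval T (instanceOf true a) xor eval T (instanceOf false a) ⟧

      0≤differs : ∀ T a → 0ℚ ≤ differs T a
      0≤differs T a = 0≤⟦⟧ (eval T (instanceOf true a) xor eval T (instanceOf false a))

      budget : ℕ → Vec (Maybe Bool) K → ℚ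
      budget q ρ = ι q * (u ^ q * revealed ρ)

      0≤u^revealed : ∀ q (ρ : Vec (Maybe Bool) K) → 0ℚ ≤ u ^ q * revealed ρ
      0≤u^revealed q ρ = 0≤* (0≤^ q 0≤u) (0≤revealed ρ)

      -- A decision tree can tell the two instances apart only by querying a marked cell, and as
      -- long as few address bits are known every cell is unlikely to be marked.
      differs-bound : ∀ T q → depth T N.≤ q → ∀ ρ → τ * 𝔼 (law ½ ρ) (differs T) ≤ budget q ρ
      differs-bound-node : ∀ j l r q → depth l N.≤ q → depth r N.≤ q → ∀ ρ s → splitAt K j ≡ s →
        τ * 𝔼 (law ½ ρ) (differs (node j l r)) ≤ budget (suc q) ρ

      differs-bound (leaf c) q _ ρ = subst (_≤ budget q ρ)
        (sym (trans (cong (τ *_) (trans (𝔼-cong (law ½ ρ) (λ _ → cong ⟦_⟧ (xor-same c))) (𝔼-const (law ½ ρ) 0ℚ))) (ℚₚ.*-zeroʳ τ)))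
        (0≤* (0≤ι q) (0≤u^revealed q ρ))
        where
        xor-same : ∀ c → c xor c ≡ false
        xor-same true  = refl
        xor-same false = refl
      differs-bound (node j l r) (suc q) (N.s≤s ≤q) ρ = differs-bound-node j l r q
        (ℕₚ.m⊔n≤o⇒m≤o (depth l) (depth r) ≤q) (ℕₚ.m⊔n≤o⇒n≤o (depth l) (depth r) ≤q) ρ (splitAt K j) refl

      differs-bound-node j l r q l≤q r≤q ρ (inj₁ i) eq with lookup ρ i in ρᵢ
      ... | just true  = subst (λ x → τ * x ≤ budget (suc q) ρ) (sym (law-determined ½ ρ i true ρᵢ branch))
          (differs-bound r (suc q) (ℕₚ.m≤n⇒m≤1+n r≤q) ρ)
        where
        branch : ∀ a → lookup a i ≡ true → differs (node j l r) a ≡ differs r a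
        branch a aᵢ rewrite eq | aᵢ = refl
      ... | just false = subst (λ x → τ * x ≤ budget (suc q) ρ) (sym (law-determined ½ ρ i false ρᵢ branch))
          (differs-bound l (suc q) (ℕₚ.m≤n⇒m≤1+n l≤q) ρ)
        where
        branch : ∀ a → lookup a i ≡ false → differs (node j l r) a ≡ differs l a
        branch a aᵢ rewrite eq | aᵢ = refl
      -- A new address bit multiplies `revealed` by u, paid for by the step from u^q to u^(q+1) in
      -- the budget.
      ... | nothing    = subst (λ x → τ * x ≤ budget (suc q) ρ) (sym (law-split ½ ρ i ρᵢ branch⁺ branch⁻))
          (ℚₚ.≤-trans (ℚₚ.≤-reflexive (halve τ (𝔼 (law ½ (ρ [ i ]≔ just true)) (differs r)) (𝔼 (law ½ (ρ [ i ]≔ just false)) (differs l))))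
            (ℚₚ.≤-trans (ℚₚ.+-mono-≤
              (*-monoʳ ½ 0≤½ (differs-bound r q r≤q (ρ [ i ]≔ just true)))
              (*-monoʳ ½ 0≤½ (differs-bound l q l≤q (ρ [ i ]≔ just false))))
            (subst₂ (λ x y → ½ * (ι q * (u ^ q * x)) + ½ * (ι q * (u ^ q * y)) ≤ budget (suc q) ρ)
              (sym (revealed-update ρ i true ρᵢ)) (sym (revealed-update ρ i false ρᵢ))
              (≤-by-diff (u ^ suc q * revealed ρ) (more (ι q) (u ^ q) u (revealed ρ)) (0≤u^revealed (suc q) ρ)))))
        where
        branch⁺ : ∀ a → lookup a i ≡ true → differs (node j l r) a ≡ differs r a
        branch⁺ a aᵢ rewrite eq | aᵢ = refl
        branch⁻ : ∀ a → lookup a i ≡ false → differs (node j l r) a ≡ differs l a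
        branch⁻ a aᵢ rewrite eq | aᵢ = refl
        halve : ∀ t x y → t * (½ * x + (1ℚ - ½) * y) ≡ ½ * (t * x) + ½ * (t * y)
        halve = solve-∀ ℚ-ring
        more : ∀ q p u f → (1ℚ + q) * (u * p * f) ≡ ½ * (q * (p * (u * f))) + ½ * (q * (p * (u * f))) + u * p * f
        more = solve-∀ ℚ-ring
      -- If the cell is marked, the event is charged to `tail`; otherwise both instances answer
      -- `false` and continue in l together. The tail costs one `revealed ρ`, covered by the
      -- additional summand of the budget.
      differs-bound-node j l r q l≤q r≤q ρ (inj₂ c) eq = ℚₚ.≤-trans
        (*-monoʳ τ 0≤τ (ℚₚ.≤-trans (𝔼-mono (law-prob ρ ½-prob) hit-or-left)
          (ℚₚ.≤-reflexive (𝔼-+ (law ½ ρ) (λ a → ⟦ close t a (decode K c) ⟧) (differs l)))))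
        (ℚₚ.≤-trans (ℚₚ.≤-reflexive (ℚₚ.*-distribˡ-+ τ (𝔼 (law ½ ρ) (λ a → ⟦ close t a (decode K c) ⟧)) (𝔼 (law ½ ρ) (differs l))))
          (ℚₚ.≤-trans (ℚₚ.+-mono-≤ (tail ρ (decode K c)) (differs-bound l q l≤q ρ))
            (≤-by-diff _ (more (ι q) (u ^ q) (revealed ρ) σ)
              (0≤+ (0≤* (0≤revealed ρ) (diff≥0 (1≤^ (suc q) 1≤u))) (0≤* (0≤* (0≤ι q) 0≤σ) (0≤u^revealed q ρ))))))
        where
        more : ∀ q p f s → (1ℚ + q) * ((1ℚ + s) * p * f) ≡ f + q * (p * f) + (f * ((1ℚ + s) * p - 1ℚ) + q * s * (p * f))
        more = solve-∀ ℚ-ring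
        bool≤1 : ∀ c → ⟦ c ⟧ ≤ 1ℚ
        bool≤1 true  = ℚₚ.≤-refl
        bool≤1 false = 0≤1
        hit-or-left : ∀ a → differs (node j l r) a ≤ ⟦ close t a (decode K c) ⟧ + differs l a
        hit-or-left a rewrite eq with close t a (decode K c)
        ... | true  = ℚₚ.≤-trans (bool≤1 (eval r (instanceOf true a) xor eval l (instanceOf false a)))
          (≤-by-diff (differs l a) refl (0≤differs l a))
        ... | false = ℚₚ.≤-reflexive (sym (ℚₚ.+-identityˡ (differs l a)))

      module _ (t≤K : t N.≤ K) where

        cell-instance : ∀ z a c → cell K t (instanceOf z a) c ≡ readBit z a (inj₂ c)
        cell-instance z a c = cong (readBit z a) (Finₚ.splitAt-↑ʳ K (2 N.^ K) c)

        address-instance : ∀ z a → address K t (instanceOf z a) ≡ a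
        address-instance z a = trans (Vecₚ.tabulate-cong (λ i → cong (readBit z a) (Finₚ.splitAt-↑ˡ K i (2 N.^ K)))) (Vecₚ.tabulate∘lookup a)

        close-self : ∀ a → close t a a ≡ true
        close-self a = dec-true (close? t a a) (subst₂ (λ x y → x N.+ t N.≤ y) (sym (proj₂ (self a))) (sym (proj₁ (self a))) t≤K)
          where
          self : ∀ {n} (a : Vec Bool n) → agreements a a ≡ n × disagreements a a ≡ 0
          self []          = refl , refl
          self (true  ∷ a) = cong suc (proj₁ (self a)) , proj₂ (self a)
          self (false ∷ a) = cong suc (proj₁ (self a)) , proj₂ (self a)

        instance-true : ∀ a → approxIndex K t (instanceOf true a) ≡ just true
        instance-true a = fromDec-true⁺ (marksNeighbours? K t (instanceOf true a)) (marksNothing? K t (instanceOf true a))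
          (λ c → trans (cell-instance true a c) (cong (λ b → close t b (decode K c)) (sym (address-instance true a))))

        -- The empty table cannot also count as correctly marked: a agrees with itself in K ≥ t
        -- places, so its own cell would have to be marked.
        instance-false : ∀ a → approxIndex K t (instanceOf false a) ≡ just false
        instance-false a = fromDec-false⁺ (marksNeighbours? K t (instanceOf false a)) (marksNothing? K t (instanceOf false a))
          (λ marks → contradiction (trans (sym (cell-instance false a (encode a))) (trans (marks (encode a))
            (trans (cong₂ (close t) (address-instance false a) (decode-encode a)) (close-self a)))) λ ())
          (cell-instance false a)

        -- When the two outputs coincide, exactly one of them is right, so the success is at most 1
        -- plus the probability that they differ, hence at most 1 + B/τ. Correctness asks for 4 ≤
        -- 3·(1 + B/τ), that is τ ≤ 3B.
        τ-bound : ∀ D → Computes D (approxIndex K t) → ∀ q → cost D N.≤ q → τ ≤ ι 3 * (ι q * u ^ q)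
        τ-bound D comp q ≤q = subst₂ _≤_ (ℚₚ.*-identityʳ τ) τ·3κB (*-monoʳ τ 0≤τ (≤-by-diff _ (reorder (κ * B)) (diff≥0 separated)))
          where
          free : Vec (Maybe Bool) K
          free = replicate K nothing
          κ B : ℚ
          κ = proj₁ (inverse 0<τ)
          B = budget q free
          τκ≡1 : τ * κ ≡ 1ℚ
          τκ≡1 = proj₁ (proj₂ (inverse 0<τ))
          revealed-free : ∀ n → revealed (replicate n nothing) ≡ 1ℚ
          revealed-free zero    = refl
          revealed-free (suc n) = revealed-free n
          swap : ∀ t k b → t * (ι 3 * (k * b)) ≡ ι 3 * (t * k * b)
          swap = solve-∀ ℚ-ring
          τ·3κB : τ * (ι 3 * (κ * B)) ≡ ι 3 * (ι q * u ^ q)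
          τ·3κB = trans (swap τ κ B) (cong (ι 3 *_) (trans (cong (_* B) τκ≡1) (trans (ℚₚ.*-identityˡ B)
            (cong (ι q *_) (trans (cong (u ^ q *_) (revealed-free K)) (ℚₚ.*-identityʳ (u ^ q)))))))
          reorder : ∀ x → ι 3 * x ≡ 1ℚ + (ι 3 * (1ℚ + x) - 2ℚ * (1ℚ + 1ℚ))
          reorder = solve-∀ ℚ-ring
          either-wrong : ∀ x y → ⟦ does (x ≟ true) ⟧ + ⟦ does (y ≟ false) ⟧ ≤ 1ℚ + ⟦ x xor y ⟧
          either-wrong true  true  = ℚₚ.≤-refl
          either-wrong true  false = ℚₚ.≤-refl
          either-wrong false true  = from-yes (0ℚ ℚₚ.≤? 1ℚ + 1ℚ)
          either-wrong false false = ℚₚ.≤-refl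
          success-bound : ∀ T → depth T N.≤ q → success (law ½ free) (law ½ free) (instanceOf true) (instanceOf false) T ≤ 1ℚ + κ * B
          success-bound T T≤q = ℚₚ.≤-trans
            (subst₂ _≤_ (𝔼-+ (law ½ free) (λ a → outputs true T (instanceOf true a)) (λ a → outputs false T (instanceOf false a)))
              (trans (𝔼-+ (law ½ free) (λ _ → 1ℚ) (differs T)) (cong (_+ 𝔼 (law ½ free) (differs T)) (𝔼-const (law ½ free) 1ℚ)))
              (𝔼-mono (law-prob free ½-prob) (λ a → either-wrong (eval T (instanceOf true a)) (eval T (instanceOf false a)))))
            (ℚₚ.+-monoʳ-≤ 1ℚ (subst (_≤ κ * B) κτE (*-monoʳ κ (proj₂ (proj₂ (inverse 0<τ))) (differs-bound T q T≤q free))))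
            where
            regroup : ∀ k t e → k * (t * e) ≡ t * k * e
            regroup = solve-∀ ℚ-ring
            κτE : κ * (τ * 𝔼 (law ½ free) (differs T)) ≡ 𝔼 (law ½ free) (differs T)
            κτE = trans (regroup κ τ _) (trans (cong (_* 𝔼 (law ½ free) (differs T)) τκ≡1) (ℚₚ.*-identityˡ _))
          separated : 2ℚ * (1ℚ + 1ℚ) ≤ ι 3 * (1ℚ + κ * B)
          separated = subst (_≤ ι 3 * (1ℚ + κ * B)) (cong (λ x → 2ℚ * (x + x)) (𝔼-const (law ½ free) 1ℚ))
            (distributional-bound (law ½ free) (law ½ free) (instanceOf true) (instanceOf false) {approxIndex K t} {D}
              (λ _ → true) (λ _ → true) (law-prob free ½-prob) (law-prob free ½-prob)
              (λ a _ → instance-true a) (λ a _ → instance-false a) success-bound comp ≤q)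

  -- With s = 1/σ, an address of s² bits and the threshold q + 5ℓs, the tail bound 2^(-5ℓ) beats
  -- a union bound over q queries.
  approxIndex-lower : ∀ {K t} h s l q → K ≡ h N.+ h → t ≡ q N.+ 5 N.* l N.* s → 0 N.< s → s N.* s ≡ K →
    12 N.* q N.< 2 N.^ (5 N.* l) → t N.≤ K → ∀ D → Computes D (approxIndex K t) → q N.≤ cost D
  approxIndex-lower {K} {t} h s l q refl refl 0<s s²≡K 12q<2⁵ˡ t≤K D comp with q ℕₚ.≤? cost D
  ... | yes q≤ = q≤
  ... | no  q≰ = contradiction 12q<2⁵ˡ (ℕₚ.≤⇒≯ (ι-cancel (subst₂ _≤_ (sym (ι-^ 2 (5 N.* l))) (sym (ι-* 12 q)) bound)))
    where
    σ u Y P : ℚ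
    σ = proj₁ (inverse (0<ι⁺ 0<s))
    u = 1ℚ + σ
    Y = u ^ q
    P = ι 2 ^ (5 N.* l)
    sσ≡1 : ι s * σ ≡ 1ℚ
    sσ≡1 = proj₁ (proj₂ (inverse (0<ι⁺ 0<s)))
    0≤σ : 0ℚ ≤ σ
    0≤σ = proj₂ (proj₂ (inverse (0<ι⁺ 0<s)))
    σ≤1 : σ ≤ 1ℚ
    σ≤1 = subst₂ _≤_ (ℚₚ.*-identityˡ σ) sσ≡1 (*-monoˡ σ 0≤σ (ι-mono {1} 0<s))
    1≤u : 1ℚ ≤ u
    1≤u = ≤-by-diff σ refl 0≤σ
    0≤uw : 0ℚ ≤ 1ℚ + - (σ * σ)
    0≤uw = diff≥0 (*-mono 0≤σ 0≤1 σ≤1 σ≤1)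
    uw : ∀ s → 1ℚ + - (s * s) ≡ (1ℚ + s) * (1ℚ - s)
    uw = solve-∀ ℚ-ring
    hσσ : 1ℚ + ι h * - (σ * σ) ≡ ½
    hσσ = trans (halve (ι h) σ) (trans (cong (λ x → 1ℚ - ½ * (x * (σ * σ))) (trans (sym (ι-+ h h)) (trans (cong ι (sym s²≡K)) (ι-* s s))))
      (trans (square (ι s) σ) (cong (λ x → 1ℚ - ½ * (x * x)) sσ≡1)))
      where
      halve : ∀ h s → 1ℚ + h * - (s * s) ≡ 1ℚ - ½ * ((h + h) * (s * s))
      halve = solve-∀ ℚ-ring
      square : ∀ s σ → 1ℚ - ½ * (s * s * (σ * σ)) ≡ 1ℚ - ½ * (s * σ * (s * σ))
      square = solve-∀ ℚ-ring
    -- Bernoulli on all K factors would only give 1 - Kσ² = 0. Half of them give 1 - hσ² = 1/2, and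
    -- squaring gives 1/4; this is why K is taken even.
    quarter : ½ * ½ ≤ (u * (1ℚ - σ)) ^ K
    quarter = subst (½ * ½ ≤_) (trans (sym (^-+ (1ℚ + - (σ * σ)) h h)) (cong (_^ K) (uw σ)))
      (*-mono 0≤½ (0≤^ h 0≤uw) half half)
      where
      half : ½ ≤ (1ℚ + - (σ * σ)) ^ h
      half = subst (_≤ (1ℚ + - (σ * σ)) ^ h) hσσ (bernoulli h 0≤uw)
    -- Since sσ = 1, Bernoulli doubles the power every s steps, and the margin 5ℓs in the threshold
    -- yields 2^(5ℓ).
    2≤uˢ : ι 2 ≤ u ^ s
    2≤uˢ = subst (_≤ u ^ s) (cong (1ℚ +_) sσ≡1) (bernoulli s (ℚₚ.≤-trans 0≤1 1≤u))
    P≤ : P ≤ u ^ (5 N.* l N.* s)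
    P≤ = subst (P ≤_) (sym (^-^-* u (5 N.* l) s)) (^-mono (5 N.* l) (0≤ι 2) 2≤uˢ)
    0<Y : 0ℚ < Y
    0<Y = ℚₚ.<-≤-trans 0<1 (1≤^ q 1≤u)
    0<P : 0ℚ < P
    0<P = ℚₚ.<-≤-trans 0<1 (1≤^ (5 N.* l) (from-yes (1ℚ ℚₚ.≤? ι 2)))
    -- The factor Y = u^q, due to the summand q of the threshold, cancels the u^q that the budget
    -- loses to revealed address bits. What remains is 2^(5ℓ)/4 ≤ 3q.
    τ : ℚ
    τ = ½ * ½ * (Y * P)
    τ≤ : τ ≤ (u * (1ℚ - σ)) ^ K * u ^ t
    τ≤ = *-mono (ℚₚ.nonNegative⁻¹ (½ * ½)) (0≤^ t (ℚₚ.≤-trans 0≤1 1≤u)) quarter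
      (subst (Y * P ≤_) (sym (^-+ u q (5 N.* l N.* s))) (*-monoʳ Y (ℚₚ.<⇒≤ 0<Y) P≤))
    0<τ : 0ℚ < τ
    0<τ = 0<* (ℚₚ.positive⁻¹ (½ * ½)) (0<* 0<Y 0<P)
    raw : τ ≤ ι 3 * (ι q * Y)
    raw = Hybrid.τ-bound σ 0≤σ σ≤1 K t τ 0<τ τ≤ t≤K D comp q (ℕₚ.<⇒≤ (ℕₚ.≰⇒> q≰))
    left : ∀ y p → 4ℚ * (½ * ½ * (y * p)) ≡ y * p
    left = solve-∀ ℚ-ring
    right : ∀ q y → 4ℚ * (ι 3 * (q * y)) ≡ y * (ι 12 * q)
    right = solve-∀ ℚ-ring
    bound : P ≤ ι 12 * ι q
    bound = *-cancelˡ Y 0<Y (subst₂ _≤_ (left Y P) (right (ι q) Y) (*-monoʳ 4ℚ (ℚₚ.nonNegative⁻¹ 4ℚ) raw))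

-- Inputs of a composed function

module Composition where
  open PromiseFunctions

  allJust⁻ : ∀ n {v : Fin n → Maybe Bool} {w} → allJust n v ≡ just w → ∀ i → v i ≡ just (w i)
  allJust⁻ (suc n) {v} eq i with v zero in v₀ | allJust n (λ i → v (suc i)) in vₛ
  allJust⁻ (suc n) refl zero    | just b | just w = v₀
  allJust⁻ (suc n) refl (suc i) | just b | just w = allJust⁻ n vₛ i

  -- The collected functions are only pointwise equal, so the two results cannot simply be equated
  -- and the outcome is a case distinction.
  allJust-cong : ∀ n {v v′ : Fin n → Maybe Bool} → v ≗ v′ →
    (allJust n v ≡ nothing × allJust n v′ ≡ nothing) ⊎ (∃ λ w → ∃ λ w′ → allJust n v ≡ just w × allJust n v′ ≡ just w′ × w ≗ w′)
  allJust-cong zero    _    = inj₂ ((λ ()) , (λ ()) , refl , refl , λ ())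
  allJust-cong (suc n) {v} {v′} v≗v′ with v zero | v′ zero | v≗v′ zero
    | allJust n (λ i → v (suc i)) | allJust n (λ i → v′ (suc i)) | allJust-cong n (λ i → v≗v′ (suc i))
  ... | nothing | .nothing  | refl | _ | _ | _ = inj₁ (refl , refl)
  ... | just b  | .(just b) | refl | nothing | nothing | inj₁ _ = inj₁ (refl , refl)
  ... | just b  | .(just b) | refl | just w | just w′ | inj₂ (_ , _ , refl , refl , w≗w′) =
    inj₂ (_ , _ , refl , refl , λ { zero → refl ; (suc i) → w≗w′ i })

  block : ∀ {n m} → Input (n N.* m) → Fin n → Input m
  block x i j = x (Fin.combine i j)

  compose⁻ : ∀ {n m} {f : PartialFn n} {g : PartialFn m} {x b} → compose f g x ≡ just b →
    ∃ λ y → (∀ i → g (block x i) ≡ just (y i)) × f y ≡ just b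
  compose⁻ {n} {g = g} {x} eq with allJust n (λ i → g (block x i)) in all
  ... | just y = y , allJust⁻ n all , eq

  compose-ext : ∀ {n m} {f : PartialFn n} {g : PartialFn m} → Extensional f → Extensional g → Extensional (compose f g)
  compose-ext {n} {f = f} {g} f-ext g-ext {x} {y} x≗y with allJust n (λ i → g (block x i)) | allJust n (λ i → g (block y i))
    | allJust-cong n (λ i → g-ext {block x i} {block y i} (λ j → x≗y (Fin.combine i j)))
  ... | nothing | nothing | inj₁ _ = refl
  ... | just w  | just w′ | inj₂ (_ , _ , refl , refl , w≗w′) = f-ext w≗w′

-- One random query per block

module Sampling where
  open OrderedField
  open Expectation
  open Concentration
  open DistributionalBound
  open DecisionTrees
  open Q using (_+_; _*_; _-_; -_; _≤_; _<_)

  -- This is the uniform mixture as soon as all m distributions have the same total weight.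
  concatFin : ∀ {n} m → (Fin m → RDT n) → RDT n
  concatFin zero    D = []
  concatFin (suc m) D = D zero ++ concatFin m (λ j → D (suc j))

  -- Query one uniformly random position of every block, then continue with the answers.
  sampling : ∀ {n m} K → (Fin K → Fin m → Fin n) → (Vec Bool K → DT n) → RDT n
  sampling zero pos k = (0 , k []) ∷ []
  sampling {m = m} (suc K) pos k = concatFin m λ j →
    sampling K (λ i → pos (suc i)) (λ v → node (pos zero j) (k (false ∷ v)) (k (true ∷ v)))

  totalWeight-concatFin : ∀ {n} m (D : Fin m → RDT n) T → (∀ j → totalWeight (D j) ≡ T) → totalWeight (concatFin m D) ≡ m N.* T
  totalWeight-concatFin zero    D T _  = refl
  totalWeight-concatFin (suc m) D T eq = trans (totalWeight-++ (D zero) (concatFin m (λ j → D (suc j))))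
    (cong₂ N._+_ (eq zero) (totalWeight-concatFin m (λ j → D (suc j)) T (λ j → eq (suc j))))

  totalWeight-sampling : ∀ {n m} K (pos : Fin K → Fin m → Fin n) k → totalWeight (sampling K pos k) ≡ m N.^ K
  totalWeight-sampling zero    pos k = refl
  totalWeight-sampling {m = m} (suc K) pos k = totalWeight-concatFin m _ (m N.^ K) (λ j → totalWeight-sampling K _ _)

  cost-concatFin : ∀ {n r} m (D : Fin m → RDT n) → (∀ j → cost (D j) N.≤ r) → cost (concatFin m D) N.≤ r
  cost-concatFin zero    D _  = N.z≤n
  cost-concatFin (suc m) D ≤r = cost-++ (D zero) (concatFin m (λ j → D (suc j))) (≤r zero) (cost-concatFin m (λ j → D (suc j)) (λ j → ≤r (suc j)))

  cost-sampling : ∀ {n m} K (pos : Fin K → Fin m → Fin n) k d → (∀ v → depth (k v) N.≤ d) → cost (sampling K pos k) N.≤ K N.+ d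
  cost-sampling zero    pos k d ≤d = ℕₚ.⊔-lub (≤d []) N.z≤n
  cost-sampling {m = m} (suc K) pos k d ≤d = cost-concatFin m _ λ j → ℕₚ.≤-trans
    (cost-sampling K (λ i → pos (suc i)) (λ v → node (pos zero j) (k (false ∷ v)) (k (true ∷ v))) (suc d) (λ v → N.s≤s (ℕₚ.⊔-lub (≤d (false ∷ v)) (≤d (true ∷ v)))))
    (ℕₚ.≤-reflexive (ℕₚ.+-suc K d))

  trues falses : ∀ {m} → Input m → ℕ
  trues  {m} y = agreements (replicate m true) (tabulate y)
  falses {m} y = disagreements (replicate m true) (tabulate y)

  trues+falses : ∀ {m} (y : Input m) → trues y N.+ falses y ≡ m
  trues+falses {zero}  y = refl
  trues+falses {suc m} y with y zero
  ... | true  = cong suc (trues+falses (λ j → y (suc j)))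
  ... | false = trans (ℕₚ.+-suc (trues (λ j → y (suc j))) _) (cong suc (trues+falses (λ j → y (suc j))))

  weightOutputting-concatFin : ∀ {n} m (D : Fin m → RDT n) x b (y : Input m) (G : Bool → ℚ) →
    (∀ j → ι (weightOutputting (D j) x b) ≡ G (y j)) →
    ι (weightOutputting (concatFin m D) x b) ≡ ι (trues y) * G true + ι (falses y) * G false
  weightOutputting-concatFin zero    D x b y G _  = sym (cong₂ _+_ (ℚₚ.*-zeroˡ (G true)) (ℚₚ.*-zeroˡ (G false)))
  weightOutputting-concatFin (suc m) D x b y G eq = trans
    (cong ι (weightOutputting-++ (D zero) (concatFin m (λ j → D (suc j))) x b))
    (trans (ι-+ (weightOutputting (D zero) x b) _)
      (trans (cong₂ _+_ (eq zero) (weightOutputting-concatFin m (λ j → D (suc j)) x b (λ j → y (suc j)) G (λ j → eq (suc j)))) count))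
    where
    add-true : ∀ a b g h → g + (a * g + b * h) ≡ (1ℚ + a) * g + b * h
    add-true = solve-∀ ℚ-ring
    add-false : ∀ a b g h → h + (a * g + b * h) ≡ a * g + (1ℚ + b) * h
    add-false = solve-∀ ℚ-ring
    y′ : Input m
    y′ j = y (suc j)
    count : G (y zero) + (ι (trues y′) * G true + ι (falses y′) * G false) ≡ ι (trues y) * G true + ι (falses y) * G false
    count with y zero
    ... | true  = add-true (ι (trues y′)) (ι (falses y′)) (G true) (G false)
    ... | false = add-false (ι (trues y′)) (ι (falses y′)) (G true) (G false)

  module _ {m : ℕ} (μ : ℚ) (mμ≡1 : ι m * μ ≡ 1ℚ) where

    frequency : Input m → ℚ
    frequency y = ι (trues y) * μ

    frequencies : ∀ {n} K → (Fin K → Fin m → Fin n) → Input n → Vec ℚ K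
    frequencies K pos x = tabulate (λ i → frequency (λ j → x (pos i j)))

    -- Positions in different blocks are chosen independently, so the bits read are independent,
    -- with the frequencies of ones in the blocks as probabilities. The factor m^K is the total
    -- weight.
    weightOutputting-sampling : ∀ {n} K (pos : Fin K → Fin m → Fin n) k x b →
      ι (weightOutputting (sampling K pos k) x b) ≡ ι m ^ K * 𝔼 (frequencies K pos x) (λ v → outputs b (k v) x)
    weightOutputting-sampling zero pos k x b = trans
      (cong ι (ℕₚ.+-identityʳ (if does (eval (k []) x ≟ b) then 1 else 0)))
      (trans (one (does (eval (k []) x ≟ b))) (sym (ℚₚ.*-identityˡ (outputs b (k []) x))))
      where
      one : ∀ c → ι (if c then 1 else 0) ≡ ⟦ c ⟧
      one true  = refl
      one false = refl
    weightOutputting-sampling (suc K) pos k x b = trans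
      (weightOutputting-concatFin m _ x b y (λ c → ι m ^ K * E c) (λ j → trans
        (weightOutputting-sampling K (λ i → pos (suc i)) (λ v → node (pos zero j) (k (false ∷ v)) (k (true ∷ v))) x b)
        (cong (ι m ^ K *_) (𝔼-cong ps (λ v → select v (x (pos zero j)))))))
      (trans (cong (λ z → ι (trues y) * (ι m ^ K * E true) + z * (ι m ^ K * E false)) falses≡)
        (trans (cong₂ (λ z z′ → z * (ι m ^ K * E true) + z′ * (ι m ^ K * E false)) (scaled (ι (trues y))) (cong (λ z → ι m - z) (scaled (ι (trues y)))))
          (assemble (ι m) (frequency y) (ι m ^ K) (E true) (E false))))
      where
      y : Input m
      y j = x (pos zero j)
      ps : Vec ℚ K
      ps = frequencies K (λ i → pos (suc i)) x
      E : Bool → ℚ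
      E c = 𝔼 ps (λ v → outputs b (k (c ∷ v)) x)
      select : ∀ v c → ⟦ does ((if c then eval (k (true ∷ v)) x else eval (k (false ∷ v)) x) ≟ b) ⟧ ≡ outputs b (k (c ∷ v)) x
      select v true  = refl
      select v false = refl
      cancel : ∀ a b → b ≡ a + b - a
      cancel = solve-∀ ℚ-ring
      falses≡ : ι (falses y) ≡ ι m - ι (trues y)
      falses≡ = trans (cancel (ι (trues y)) (ι (falses y))) (cong (_- ι (trues y)) (trans (sym (ι-+ (trues y) (falses y))) (cong ι (trues+falses y))))
      swap : ∀ m t u → t * (m * u) ≡ m * (t * u)
      swap = solve-∀ ℚ-ring
      scaled : ∀ t → t ≡ ι m * (t * μ)
      scaled t = trans (sym (ℚₚ.*-identityʳ t)) (trans (cong (t *_) (sym mμ≡1)) (swap (ι m) t μ))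
      assemble : ∀ m p k a b → m * p * (k * a) + (m - m * p) * (k * b) ≡ m * k * (p * a + (1ℚ - p) * b)
      assemble = solve-∀ ℚ-ring

-- Upper bound for the composition

module CompositionUpperBound where
  open OrderedField
  open Expectation
  open Concentration
  open DistributionalBound
  open DecisionTrees
  open PromiseFunctions
  open GapMajorityLowerBound using (replicate-far; not-both-close)
  open Composition
  open Sampling
  open Q using (_+_; _*_; _-_; -_; _≤_; _<_)

  -- `biased` says that K samples of drift t/M have mean correlation at least 2D with the address;
  -- `spread` says that the Chebyshev failure K/D² is within the permitted error 1/3.
  module _ (K D M t : ℕ) (0<M : 0 N.< M) (0<t : 0 N.< t) (0<D : 0 N.< D)
    (biased : (D N.+ D) N.* M N.≤ K N.* t) (spread : 3 N.* K N.≤ D N.* D) where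

    private
      n : ℕ
      n = (K N.+ 2 N.^ K) N.* M

      h : PartialFn n
      h = compose (approxIndex K D) (gapMajority M t)

      sample : Fin K → Fin M → Fin n
      sample i j = Fin.combine (i ↑ˡ (2 N.^ K)) j

      cellPositions : Vec Bool K → Vec (Fin n) M
      cellPositions v = tabulate (Fin.combine (K ↑ʳ encode v))

      decide : Vec Bool M → DT n
      decide z = leaf (close t (replicate M true) z)

      readCell : Vec Bool K → DT n
      readCell v = query (cellPositions v) decide

      readCell-depth : ∀ v → depth (readCell v) N.≤ M
      readCell-depth v = subst (depth (readCell v) N.≤_) (ℕₚ.+-identityʳ M) (depth-query (cellPositions v) (λ _ → N.z≤n))

      algorithm : RDT n
      algorithm = sampling K sample readCell

      μ : ℚ
      μ = proj₁ (inverse (0<ι⁺ 0<M))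

      Mμ≡1 : ι M * μ ≡ 1ℚ
      Mμ≡1 = proj₁ (proj₂ (inverse (0<ι⁺ 0<M)))

      0≤μ : 0ℚ ≤ μ
      0≤μ = proj₂ (proj₂ (inverse (0<ι⁺ 0<M)))

      module _ {x : Input n} {y : Input (K N.+ 2 N.^ K)} (gx : ∀ i → gapMajority M t (block {K N.+ 2 N.^ K} {M} x i) ≡ just (y i)) where

        xs : Fin (K N.+ 2 N.^ K) → Input M
        xs = block x

        block-close : ∀ i {b} → y i ≡ b → Close t (replicate M b) (tabulate (xs i))
        block-close i {b} yᵢ with y i | gx i
        block-close i {true}  refl | .true  | g = fromDec-true⁻ (close? t (replicate M true) (tabulate (xs i))) _ g
        block-close i {false} refl | .false | g = fromDec-false⁻ (close? t (replicate M true) (tabulate (xs i))) _ g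

        -- The block of the cell is read completely and satisfies the promise of g, so its value is
        -- obtained without error.
        eval-readCell : ∀ v → eval (readCell v) x ≡ y (K ↑ʳ encode v)
        eval-readCell v = trans (eval-query (cellPositions v) decide x)
          (trans (cong (close t (replicate M true)) (sym (Vecₚ.tabulate-∘ x (Fin.combine (K ↑ʳ encode v)))))
            (value (y (K ↑ʳ encode v)) refl))
          where
          value : ∀ b → y (K ↑ʳ encode v) ≡ b → close t (replicate M true) (tabulate (xs (K ↑ʳ encode v))) ≡ b
          value true  eq = dec-true (close? t (replicate M true) _) (block-close (K ↑ʳ encode v) eq)
          value false eq = dec-false (close? t (replicate M true) _) (not-both-close (tabulate (xs (K ↑ʳ encode v))) 0<t (block-close (K ↑ʳ encode v) eq))

        ps : Vec ℚ K
        ps = frequencies μ Mμ≡1 K sample x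

        ps-prob : All IsProb ps
        ps-prob = tabulate⁺ (λ i → 0≤* (0≤ι (trues (λ j → x (sample i j)))) 0≤μ ,
          subst (frequency μ Mμ≡1 (λ j → x (sample i j)) ≤_) Mμ≡1 (*-monoˡ μ 0≤μ (ι-mono (subst (trues (λ j → x (sample i j)) N.≤_) (trues+falses (λ j → x (sample i j))) (ℕₚ.m≤m+n _ _)))))

        -- The promise gives the value b a surplus of t among the M positions of the block, so a
        -- uniformly random position favours b by t/M.
        frequency-drift : ∀ i b → Close t (replicate M b) (tabulate (xs i)) → ι t * μ ≤ drift b (frequency μ Mμ≡1 (xs i))
        frequency-drift i b cl = go b cl
          where
          T F : ℕ
          T = trues (xs i)
          F = falses (xs i)
          unit : (ι T + ι F) * μ ≡ 1ℚ
          unit = trans (cong (_* μ) (trans (sym (ι-+ T F)) (cong ι (trues+falses (xs i))))) Mμ≡1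
          surplus⁺ : ∀ T F t m → T * m + T * m - (T + F) * m ≡ t * m + (T - (F + t)) * m
          surplus⁺ = solve-∀ ℚ-ring
          surplus⁻ : ∀ T F t m → (T + F) * m - (T * m + T * m) ≡ t * m + (F - (T + t)) * m
          surplus⁻ = solve-∀ ℚ-ring
          ι-gap : ∀ {A B} → A N.+ t N.≤ B → 0ℚ ≤ (ι B - (ι A + ι t)) * μ
          ι-gap {A} {B} A+t≤B = 0≤* (diff≥0 (subst (_≤ ι B) (ι-+ A t) (ι-mono A+t≤B))) 0≤μ
          go : ∀ b → Close t (replicate M b) (tabulate (xs i)) → ι t * μ ≤ drift b (ι T * μ)
          go true  cl = ≤-by-diff _ (trans (cong (λ z → ι T * μ + ι T * μ - z) (sym unit)) (surplus⁺ (ι T) (ι F) (ι t) μ)) (ι-gap {F} {T} cl)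
          go false cl = ≤-by-diff _ (trans (cong (λ z → z - (ι T * μ + ι T * μ)) (sym unit)) (surplus⁻ (ι T) (ι F) (ι t) μ))
            (ι-gap {T} {F} (subst₂ (λ d a → d N.+ t N.≤ a) (proj₂ (replicate-far true (tabulate (xs i)))) (proj₁ (replicate-far true (tabulate (xs i)))) cl))

        enough : ∀ b → ι 2 ≤ ι 3 * 𝔼 ps (λ v → outputs b (readCell v) x) →
          2 N.* totalWeight algorithm N.≤ 3 N.* weightOutputting algorithm x b
        enough b 2≤3E = ι-cancel (subst₂ _≤_
          (sym (trans (ι-* 2 (totalWeight algorithm)) (cong (ι 2 *_) (trans (cong ι (totalWeight-sampling K sample readCell)) (ι-^ M K)))))
          (sym (trans (ι-* 3 (weightOutputting algorithm x b)) (trans (cong (ι 3 *_) (weightOutputting-sampling μ Mμ≡1 K sample readCell x b))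
            (swap (ι 3) (ι M ^ K) _))))
          (*-monoˡ (ι M ^ K) (0≤^ K (0≤ι M)) 2≤3E))
          where
          swap : ∀ a m e → a * (m * e) ≡ a * e * m
          swap = solve-∀ ℚ-ring

        -- On an empty table every guess leads to an empty cell, so the error is one-sided.
        correct-false : MarksNothing K D y → ι 2 ≤ ι 3 * 𝔼 ps (λ v → outputs false (readCell v) x)
        correct-false zeros = subst (λ e → ι 2 ≤ ι 3 * e)
          (sym (trans (𝔼-cong ps (λ v → cong (λ b → ⟦ does (b ≟ false) ⟧) (trans (eval-readCell v) (zeros (encode v))))) (𝔼-const ps 1ℚ)))
          (from-yes (ι 2 ℚₚ.≤? ι 3 * 1ℚ))

        -- The cell read is marked exactly when the sampled guess is close to the address, which
        -- fails with probability at most 1/3.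
        correct-true : MarksNeighbours K D y → ι 2 ≤ ι 3 * 𝔼 ps (λ v → outputs true (readCell v) x)
        correct-true marks = ℚₚ.≤-trans good (*-monoʳ (ι 3) (0≤ι 3) (ℚₚ.≤-reflexive (𝔼-cong ps output)))
          where
          a : Vec Bool K
          a = address K D y
          bool-test : ∀ b → ⟦ b ⟧ ≡ ⟦ does (b ≟ true) ⟧
          bool-test true  = refl
          bool-test false = refl
          output : ∀ v → ⟦ close D a v ⟧ ≡ outputs true (readCell v) x
          output v = trans (bool-test (close D a v)) (cong (λ b → ⟦ does (b ≟ true) ⟧)
            (sym (trans (eval-readCell v) (trans (marks (encode v)) (cong (close D a) (decode-encode v))))))
          drifts : ∀ i → ι t * μ ≤ drift (lookup a i) (lookup ps i)
          drifts i = subst₂ (λ b p → ι t * μ ≤ drift b p)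
            (sym (Vecₚ.lookup∘tabulate (λ i → y (i ↑ˡ (2 N.^ K))) i))
            (sym (Vecₚ.lookup∘tabulate (λ i → frequency μ Mμ≡1 (λ j → x (sample i j))) i))
            (frequency-drift (i ↑ˡ (2 N.^ K)) (y (i ↑ˡ (2 N.^ K))) (block-close (i ↑ˡ (2 N.^ K)) refl))
          spread-out : ∀ d m u → (d + d) * m * u ≡ (d + d) * (m * u)
          spread-out = solve-∀ ℚ-ring
          far-mean : ι D + ι D ≤ mean a ps
          far-mean = ℚₚ.≤-trans (subst₂ _≤_
            (trans (cong (_* μ) (trans (ι-* (D N.+ D) M) (cong (_* ι M) (ι-+ D D)))) (trans (spread-out (ι D) (ι M) μ)
              (trans (cong ((ι D + ι D) *_) Mμ≡1) (ℚₚ.*-identityʳ (ι D + ι D)))))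
            (trans (cong (_* μ) (ι-* K t)) (ℚₚ.*-assoc (ι K) (ι t) μ))
            (*-monoˡ μ 0≤μ (ι-mono biased)))
            (mean-lower a ps drifts)
          bad : ℚ
          bad = 𝔼 ps (λ v → ⟦ not (close D a v) ⟧)
          triple : ∀ d b → ι 3 * (d * b) ≡ d * (ι 3 * b)
          triple = solve-∀ ℚ-ring
          3bad : ι 3 * bad ≤ 1ℚ
          3bad = *-cancelˡ (ι D * ι D) (0<* (0<ι⁺ 0<D) (0<ι⁺ 0<D)) (subst₂ _≤_ (triple (ι D * ι D) bad) (sym (ℚₚ.*-identityʳ (ι D * ι D)))
            (ℚₚ.≤-trans (*-monoʳ (ι 3) (0≤ι 3) (chebyshev D a ps-prob far-mean))
              (subst₂ _≤_ (ι-* 3 K) (ι-* D D) (ι-mono spread))))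
          rest : ∀ p b → ι 3 * p ≡ (p + b) * ι 3 - 1ℚ + (1ℚ - ι 3 * b)
          rest = solve-∀ ℚ-ring
          good : ι 2 ≤ ι 3 * 𝔼 ps (λ v → ⟦ close D a v ⟧)
          good = ≤-by-diff _ (trans (rest (𝔼 ps (λ v → ⟦ close D a v ⟧)) bad)
            (cong (λ z → z * ι 3 - 1ℚ + (1ℚ - ι 3 * bad)) (𝔼-complement ps (close D a)))) (diff≥0 3bad)

    composition-upper : ∃ λ A → Computes A h × cost A N.≤ K N.+ M
    composition-upper = algorithm , (positive , correct) , cost-sampling K sample readCell M readCell-depth
      where
      positive : 0 N.< totalWeight algorithm
      positive = subst (0 N.<_) (sym (totalWeight-sampling K sample readCell)) (ℕₚ.m^n>0 M {{N.>-nonZero 0<M}} K)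
      correct : ∀ x b → h x ≡ just b → 2 N.* totalWeight algorithm N.≤ 3 N.* weightOutputting algorithm x b
      correct x b hx with compose⁻ {f = approxIndex K D} {gapMajority M t} {x} hx
      correct x true  _ | y , gx , fy = enough gx true (correct-true gx (fromDec-true⁻ (marksNeighbours? K D y) (marksNothing? K D y) fy))
      correct x false _ | y , gx , fy = enough gx false (correct-false gx (fromDec-false⁻ (marksNeighbours? K D y) (marksNothing? K D y) fy))

-- Choice of parameters

-- Up to rounding ℓ = log R(f); one query to g has bias at least t/M = 1/r, so that K samples have an
-- expected surplus of K/r = 2D agreements.
record Parameters (k : ℕ) : Set where
  open N using (_+_; _*_; _^_; _≤_; _<_)
  field
    ℓ r s q h K D M t : ℕ
    r≡2^ℓ  : r ≡ 2 ^ ℓ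
    K≡h+h  : K ≡ h + h
    D≡     : D ≡ q + 5 * ℓ * s
    M≡16r² : M ≡ 16 * (r * r)
    t≡16r  : t ≡ 16 * r
    s²≡K   : s * s ≡ K
    k<r    : k < r
    2≤r    : 2 ≤ r
    0<s    : 0 < s
    0<D    : 0 < D
    0<M    : 0 < M
    0<t    : 0 < t
    D≤K    : D ≤ K
    r≤q    : r ≤ q
    ℓℓr≤q  : ℓ * (ℓ * r) ≤ q
    K+M≤   : K + M ≤ 160 * (ℓ * r * (ℓ * r))
    12q<2^5ℓ : 12 * q < 2 ^ (5 * ℓ)
    biased   : (D + D) * M ≤ K * t
    spread   : 3 * K ≤ D * D

  F : PartialFn (K + 2 ^ K)
  F = PromiseFunctions.approxIndex K D

  G : PartialFn M
  G = PromiseFunctions.gapMajority M t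

  R-F : ∃ (IsR F)
  R-F = RandomizedComplexity.R-exists F (PromiseFunctions.approxIndex-ext K D)

  R-G : ∃ (IsR G)
  R-G = RandomizedComplexity.R-exists G (PromiseFunctions.gapMajority-ext M t)

  R-FG : ∃ (IsR (compose F G))
  R-FG = RandomizedComplexity.R-exists (compose F G)
    (Composition.compose-ext {f = F} {G} (PromiseFunctions.approxIndex-ext K D) (PromiseFunctions.gapMajority-ext M t))

  q≤R-F : q ≤ proj₁ R-F
  q≤R-F = let A , comp , A≤ = proj₁ (proj₂ R-F) in ℕₚ.≤-trans
    (ApproxIndexLowerBound.approxIndex-lower h s ℓ q K≡h+h D≡ 0<s s²≡K 12q<2^5ℓ D≤K A comp) A≤

  r²≤512R-G : r * r ≤ 512 * proj₁ R-G
  r²≤512R-G = let A , comp , A≤ = proj₁ (proj₂ R-G) in ℕₚ.≤-trans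
    (GapMajorityLowerBound.gapMajority-lower r 2≤r M≡16r² t≡16r A comp) (ℕₚ.*-monoʳ-≤ 512 A≤)

  R-FG-upper : proj₁ R-FG ≤ 160 * (ℓ * r * (ℓ * r))
  R-FG-upper =
    let A , comp , A≤ = CompositionUpperBound.composition-upper K D M t 0<M 0<t 0<D biased spread
    in ℕₚ.≤-trans (proj₂ (proj₂ R-FG) A comp) (ℕₚ.≤-trans A≤ K+M≤)

  -- Here r ≤ q pays off: R(f) is at least r = 2^ℓ, so its logarithm can replace ℓ in the final
  -- bound.
  ℓ≤log : ℓ ≤ ⌈log₂ proj₁ R-F ⌉
  ℓ≤log = ℕₚ.≤-trans (ℕₚ.≤-reflexive (sym (⌈log₂2^n⌉≡n ℓ)))
    (⌈log₂⌉-mono-≤ (subst (_≤ proj₁ R-F) r≡2^ℓ (ℕₚ.≤-trans r≤q q≤R-F)))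

module _ where
  open N using (_+_; _*_; _^_; _≤_; _<_)

  n<2^n : ∀ n → n < 2 ^ n
  n<2^n zero    = N.s≤s N.z≤n
  n<2^n (suc n) = ℕₚ.+-mono-≤ (ℕₚ.m^n>0 2 n) (ℕₚ.≤-trans (n<2^n n) (ℕₚ.m≤m+n (2 ^ n) 0))

  -- With q = ℓs the threshold is D = 6ℓs, a constant multiple of q. The bias condition with
  -- equality reads 2D·r = K, that is 12ℓs·r = s², which forces s = 12ℓr and K = 144ℓ²r². Then D² =
  -- 36ℓ²K exceeds 3K, and K + M ≤ (144 + 16)ℓ²r².
  parametersFrom : ∀ k ℓ r → r ≡ 2 ^ ℓ → k < r → 1 ≤ ℓ → ℓ < r → 16 ≤ r → Parameters k
  parametersFrom k ℓ r r≡2^ℓ k<r 1≤ℓ ℓ<r 16≤r = record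
    { ℓ = ℓ ; r = r ; s = s ; q = q ; h = h ; K = h + h ; D = q + 5 * ℓ * s ; M = 16 * (r * r) ; t = 16 * r
    ; r≡2^ℓ = r≡2^ℓ ; K≡h+h = refl ; D≡ = refl ; M≡16r² = refl ; t≡16r = refl
    ; s²≡K = square (ℓ * r)
    ; k<r = k<r
    ; 2≤r = ℕₚ.≤-trans (N.s≤s (N.s≤s N.z≤n)) 16≤r
    ; 0<s = 0<s
    ; 0<D = ℕₚ.≤-trans (ℕₚ.≤-trans 0<s s≤q) (ℕₚ.m≤m+n q (5 * ℓ * s))
    ; 0<M = ℕₚ.≤-trans (ℕₚ.*-mono-≤ 0<r 0<r) (ℕₚ.m≤n*m (r * r) 16)
    ; 0<t = ℕₚ.≤-trans 0<r (ℕₚ.m≤n*m r 16)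
    ; D≤K = D≤K
    ; r≤q = ℕₚ.≤-trans r≤ℓr (ℕₚ.≤-trans ℓr≤s s≤q)
    ; ℓℓr≤q = ℕₚ.*-monoʳ-≤ ℓ ℓr≤s
    ; K+M≤ = ℕₚ.≤-trans (ℕₚ.+-monoʳ-≤ (h + h) (ℕₚ.*-monoʳ-≤ 16 (ℕₚ.*-mono-≤ r≤ℓr r≤ℓr))) (ℕₚ.≤-reflexive (collect₁ (ℓ * r * (ℓ * r))))
    ; 12q<2^5ℓ = 12q<2^5ℓ
    ; biased = ℕₚ.≤-reflexive (expand₁ ℓ r)
    ; spread = ℕₚ.≤-trans (ℕₚ.m≤m*n (3 * (h + h)) (12 * (ℓ * ℓ)) {{N.>-nonZero (ℕₚ.≤-trans (ℕₚ.*-mono-≤ 1≤ℓ 1≤ℓ) (ℕₚ.m≤n*m (ℓ * ℓ) 12))}})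
        (ℕₚ.≤-reflexive (expand₂ ℓ r))
    }
    where
    open ℕₚ.≤-Reasoning
    s q h : ℕ
    s = 12 * (ℓ * r)
    q = ℓ * s
    h = 72 * (ℓ * r * (ℓ * r))
    0<r : 0 < r
    0<r = ℕₚ.≤-trans (N.s≤s N.z≤n) 16≤r
    r≤ℓr : r ≤ ℓ * r
    r≤ℓr = ℕₚ.m≤n*m r ℓ {{N.>-nonZero 1≤ℓ}}
    ℓr≤s : ℓ * r ≤ s
    ℓr≤s = ℕₚ.m≤n*m (ℓ * r) 12
    0<s : 0 < s
    0<s = ℕₚ.≤-trans 0<r (ℕₚ.≤-trans r≤ℓr ℓr≤s)
    s≤q : s ≤ q
    s≤q = ℕₚ.m≤n*m s ℓ {{N.>-nonZero 1≤ℓ}}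
    square : ∀ x → 12 * x * (12 * x) ≡ 72 * (x * x) + 72 * (x * x)
    square = ℕ-Solver.solve-∀
    collect₁ : ∀ x → 72 * x + 72 * x + 16 * x ≡ 160 * x
    collect₁ = ℕ-Solver.solve-∀
    expand₁ : ∀ l r → (l * (12 * (l * r)) + 5 * l * (12 * (l * r)) + (l * (12 * (l * r)) + 5 * l * (12 * (l * r)))) * (16 * (r * r))
      ≡ (72 * (l * r * (l * r)) + 72 * (l * r * (l * r))) * (16 * r)
    expand₁ = ℕ-Solver.solve-∀
    expand₂ : ∀ l r → 3 * (72 * (l * r * (l * r)) + 72 * (l * r * (l * r))) * (12 * (l * l))
      ≡ (l * (12 * (l * r)) + 5 * l * (12 * (l * r))) * (l * (12 * (l * r)) + 5 * l * (12 * (l * r)))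
    expand₂ = ℕ-Solver.solve-∀
    -- Here 12q = 144ℓ²r. Replacing both factors ℓ by r and 144 by r² gives r^5, hence the exponent
    -- 5ℓ.
    12q<2^5ℓ : 12 * q < 2 ^ (5 * ℓ)
    12q<2^5ℓ = begin-strict
      12 * q                       ≡⟨ collect ℓ r ⟩
      144 * (ℓ * (ℓ * r))          <⟨ ℕₚ.*-monoʳ-< 144 (ℕₚ.*-monoʳ-< ℓ {{N.>-nonZero 1≤ℓ}} (ℕₚ.*-monoˡ-< r {{N.>-nonZero 0<r}} ℓ<r)) ⟩
      144 * (ℓ * (r * r))          ≤⟨ ℕₚ.*-mono-≤ (ℕₚ.≤-trans (ℕₚ.m≤m+n 144 112) (ℕₚ.*-mono-≤ 16≤r 16≤r)) (ℕₚ.*-monoˡ-≤ (r * r) (ℕₚ.<⇒≤ ℓ<r)) ⟩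
      r * r * (r * (r * r))        ≡⟨ fifth r ⟩
      r ^ 5                        ≡⟨ cong (_^ 5) r≡2^ℓ ⟩
      (2 ^ ℓ) ^ 5                  ≡⟨ trans (ℕₚ.^-*-assoc 2 ℓ 5) (cong (2 ^_) (ℕₚ.*-comm ℓ 5)) ⟩
      2 ^ (5 * ℓ)                  ∎
      where
      collect : ∀ l r → 12 * (l * (12 * (l * r))) ≡ 144 * (l * (l * r))
      collect = ℕ-Solver.solve-∀
      fifth : ∀ r → r * r * (r * (r * r)) ≡ r * (r * (r * (r * (r * 1))))
      fifth = ℕ-Solver.solve-∀
    D≤K : q + 5 * ℓ * s ≤ h + h
    D≤K = begin
      q + 5 * ℓ * s                  ≡⟨ collect ℓ s ⟩
      6 * ℓ * s                      ≤⟨ ℕₚ.*-monoˡ-≤ s (ℕₚ.*-monoˡ-≤ ℓ (ℕₚ.m≤m+n 6 6)) ⟩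
      12 * ℓ * s                     ≤⟨ ℕₚ.*-monoˡ-≤ s (ℕₚ.m≤m*n (12 * ℓ) r {{N.>-nonZero 0<r}}) ⟩
      12 * ℓ * r * s                 ≡⟨ cong (_* s) (ℕₚ.*-assoc 12 ℓ r) ⟩
      s * s                          ≡⟨ square (ℓ * r) ⟩
      h + h                          ∎
      where
      collect : ∀ l s → l * s + 5 * l * s ≡ 6 * l * s
      collect = ℕ-Solver.solve-∀

  abstract
    parameters : ∀ k → Parameters k
    -- The offset 4 ensures r ≥ 16, whence 144 ≤ r².
    parameters k = parametersFrom k (4 + k) (2 ^ (4 + k)) refl
      (ℕₚ.<-≤-trans (n<2^n k) (ℕₚ.^-monoʳ-≤ 2 (ℕₚ.m≤n+m k 4))) (N.s≤s N.z≤n) (n<2^n (4 + k)) (ℕₚ.^-monoʳ-≤ 2 (ℕₚ.m≤m+n 4 k))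

-- The cubed bound and growth

module Asymptotics where
  open N using (_+_; _*_; _^_; _≤_; _<_)
  open ℕₚ.≤-Reasoning

  -- The powers match: (l²r²)³ = (l²r)² · (r²)² · l², whose factors are bounded by R(f)², a multiple
  -- of R(g)², and the squared logarithm.
  cube-bound : ∀ c d {n l r a g L} → n ≤ c * (l * r * (l * r)) → l * (l * r) ≤ a → r * r ≤ d * g → l ≤ L →
    n ^ 3 ≤ c ^ 3 * d ^ 2 * (a ^ 2 * g ^ 2 * L ^ 2)
  cube-bound c d {n} {l} {r} {a} {g} {L} n≤ ≤a ≤dg l≤L = begin
    n ^ 3                                               ≤⟨ ℕₚ.^-monoˡ-≤ 3 n≤ ⟩
    (c * (l * r * (l * r))) ^ 3                         ≡⟨ regroup c l r ⟩
    c ^ 3 * ((l * (l * r)) ^ 2 * (r * r) ^ 2 * l ^ 2)   ≤⟨ ℕₚ.*-monoʳ-≤ (c ^ 3) (ℕₚ.*-mono-≤ (ℕₚ.*-mono-≤ (ℕₚ.^-monoˡ-≤ 2 ≤a) (ℕₚ.^-monoˡ-≤ 2 ≤dg)) (ℕₚ.^-monoˡ-≤ 2 l≤L)) ⟩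
    c ^ 3 * (a ^ 2 * (d * g) ^ 2 * L ^ 2)               ≡⟨ collect c d a g L ⟩
    c ^ 3 * d ^ 2 * (a ^ 2 * g ^ 2 * L ^ 2)             ∎
    where
    regroup : ∀ c l r → (c * (l * r * (l * r))) * ((c * (l * r * (l * r))) * ((c * (l * r * (l * r))) * 1)) ≡
      (c * (c * (c * 1))) * (((l * (l * r)) * ((l * (l * r)) * 1)) * ((r * r) * ((r * r) * 1)) * (l * (l * 1)))
    regroup = ℕ-Solver.solve-∀
    collect : ∀ c d a g L → (c * (c * (c * 1))) * ((a * (a * 1)) * ((d * g) * ((d * g) * 1)) * (L * (L * 1))) ≡
      (c * (c * (c * 1))) * (d * (d * 1)) * ((a * (a * 1)) * (g * (g * 1)) * (L * (L * 1)))
    collect = ℕ-Solver.solve-∀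

  eventually-bounded : ∀ c d (rf rg rfg l r : ℕ → ℕ) →
    (∀ k → rfg k ≤ c * (l k * r k * (l k * r k))) → (∀ k → l k * (l k * r k) ≤ rf k) → (∀ k → r k * r k ≤ d * rg k) →
    (∀ k → l k ≤ ⌈log₂ rf k ⌉) →
    ∃ λ C → ∃ λ N → ∀ k → N ≤ k → rfg k ^ 3 ≤ C * (rf k ^ 2 * rg k ^ 2 * ⌈log₂ rf k ⌉ ^ 2)
  eventually-bounded c d rf rg rfg l r up lf lg ll = c ^ 3 * d ^ 2 , 0 , λ k _ → cube-bound c d {l = l k} {r k} {g = rg k} (up k) (lf k) (lg k) (ll k)

  grows : ∀ d .{{_ : N.NonZero d}} (R : ℕ → ℕ) → (∀ k → k ≤ d * R k) → TendsToInfinity R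
  grows d R k≤dR m = d * m , λ k dm≤k → ℕₚ.*-cancelˡ-≤ d (ℕₚ.≤-trans dm≤k (k≤dR k))

open import Data.Nat using (_*_; _^_; _≤_)

theorem1p2 : Σ (ℕ → ℕ) λ a → Σ (ℕ → ℕ) λ b →
    Σ ((k : ℕ) → PartialFn (a k)) λ f → Σ ((k : ℕ) → PartialFn (b k)) λ g →
    Σ (ℕ → ℕ) λ rf → Σ (ℕ → ℕ) λ rg → Σ (ℕ → ℕ) λ rfg →
    (∀ k → IsR (f k) (rf k)) ×
    (∀ k → IsR (g k) (rg k)) ×
    (∀ k → IsR (compose (f k) (g k)) (rfg k)) ×
    TendsToInfinity rf ×
    TendsToInfinity rg ×
    (∃ λ C → ∃ λ N → ∀ k → N ≤ k →
    rfg k ^ 3 ≤ C * (rf k ^ 2 * rg k ^ 2 * ⌈log₂ rf k ⌉ ^ 2))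
theorem1p2 =
  (λ k → K (P k) N.+ 2 ^ K (P k)) , (λ k → M (P k)) , (λ k → F (P k)) , (λ k → G (P k)) ,
  (λ k → proj₁ (R-F (P k))) , (λ k → proj₁ (R-G (P k))) , (λ k → proj₁ (R-FG (P k))) ,
  (λ k → proj₂ (R-F (P k))) , (λ k → proj₂ (R-G (P k))) , (λ k → proj₂ (R-FG (P k))) ,
  grows 1 _ (λ k → ℕₚ.≤-trans (ℕₚ.<⇒≤ (k<r (P k))) (ℕₚ.≤-trans (r≤q (P k)) (ℕₚ.≤-trans (q≤R-F (P k)) (ℕₚ.m≤m+n _ 0)))) ,
  grows 512 _ (λ k → ℕₚ.≤-trans (ℕₚ.<⇒≤ (k<r (P k))) (ℕₚ.≤-trans
    (ℕₚ.m≤m*n (r (P k)) (r (P k)) {{N.>-nonZero (ℕₚ.≤-<-trans N.z≤n (k<r (P k)))}}) (r²≤512R-G (P k)))) ,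
  eventually-bounded 160 512 _ (λ k → proj₁ (R-G (P k))) _ (λ k → ℓ (P k)) (λ k → r (P k)) (λ k → R-FG-upper (P k))
    (λ k → ℕₚ.≤-trans (ℓℓr≤q (P k)) (q≤R-F (P k))) (λ k → r²≤512R-G (P k)) (λ k → ℓ≤log (P k))
  where
  open Parameters
  open Asymptotics
  P : ∀ k → Parameters k
  P = parameters
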